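{- There are exactly fifteen $\overline{\mathbb{Q}}$-conjugacy classes of cubic postcritically finite polynomials defined over $\mathbb{Q}$, represented by the following polynomials. That is, each of the following fifteen polynomials is postcritically finite, no two of them are conjugate over $\overline{\mathbb{Q}}$, and every postcritically finite polynomial $f(z)\in\mathbb{Q}[z]$ of degree $3$ is conjugate over $\overline{\mathbb{Q}}$ to one of them: (1) $z^3$; (2) $-z^3+1$; (3) $-2z^3+3z^2+\frac12$; (4) $-2z^3+3z^2$; (5) $-z^3+\frac32 z^2+1$; (6) $2z^3-3z^2+1$; (7) $2z^3-3z^2+\frac12$; (8) $z^3-\frac32 z^2$; (9) $-3z^3+\frac92 z^2$; (10) $-4z^3+6z^2-\frac12$; (11) $4z^3-6z^2+\frac32$; (12) $3z^3-\frac92 z^2+1$; (13) $-z^3+\frac32 z^2-1$; (14) $-\frac14 z^3+\frac32 z+2$; (15) $-\frac1{28}z^3-\frac34 z+\frac72$.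
   Context: For a polynomial $f$, $f^n$ denotes the $n$-th iterate ($f^0(z)=z$). The orbit of $\alpha$ is $\{f^n(\alpha): n\ge 0\}$. Critical points of $f$ are the $\alpha\in\overline{\mathbb{Q}}$ with $f'(\alpha)=0$. $f$ is postcritically finite (PCF) if the orbit of each critical point is finite. Polynomials $f,g$ are conjugate over $\overline{\mathbb{Q}}$ if $g=\phi\circ f\circ\phi^{ -1}$ for some affine map $\phi(z)=\alpha z+\beta$ with $\alpha,\beta\in\overline{\mathbb{Q}}$, $\alpha\ne 0$. -}

module Defs where

open import Agda.Builtin.FromNat using (Number; fromNat)
open import Agda.Builtin.FromNeg using (Negative; fromNeg)
open import Algebra.Apartness.Bundles using (HeytingField; HeytingCommutativeRing)
open import Algebra.Bundles using (CommutativeRing)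
open import Algebra.Morphism.Structures using (IsRingHomomorphism)
open import Data.Integer.Base using (ℤ)
import Data.Integer.Literals as ℤLiterals
open import Data.List.Base using (List; []; _∷_; foldr; map)
import Data.List.Membership.Setoid as SetoidMembership
open import Data.Nat.Base using (ℕ; zero; suc; _<_)
open import Data.Nat.GeneralisedArithmetic using (iterate)
import Data.Nat.Literals as ℕLiterals
open import Data.Product.Base using (Σ; ∃-syntax; _×_; proj₁)
open import Data.Rational.Base using (ℚ; _/_; +-*-rawRing)
import Data.Rational.Properties as ℚ
open import Data.Unit.Base using (⊤; tt)
open import Data.Vec.Base using (Vec; []; _∷_)
open import Function.Bundles using (_⇔_)
open import Level using (Level; _⊔_) renaming (suc to lsuc)
open import Relation.Binary.Definitions using (Decidable)
open import Relation.Unary using (Pred)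

private
  instance
    ℕ-number : Number ℕ
    ℕ-number = ℕLiterals.number

    ℤ-number : Number ℤ
    ℤ-number = ℤLiterals.number

    ℤ-negative : Negative ℤ
    ℤ-negative = ℤLiterals.negative

-- Here x # y is the library's notion of "x and y are distinct" in a field: it
-- is _≢_ for ℚ, and the negation of _≈_ for every field with decidable _#_.
module Polynomials {c ℓ₁ ℓ₂} (F : HeytingField c ℓ₁ ℓ₂) where

  open HeytingField F
  open CommutativeRing (HeytingCommutativeRing.commutativeRing heytingCommutativeRing)
    using (+-rawMonoid)
  open import Algebra.Definitions.RawMonoid +-rawMonoid using () renaming (_×_ to _×ₙ_)
  open SetoidMembership setoid using (_∈_)

  -- a₀ ∷ a₁ ∷ a₂ ∷ … is a₀ + a₁z + a₂z² + …; trailing zeros are allowed, so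
  -- equality of polynomials is _≈ᴾ_ and the degree is not read off the length.
  Poly : Set c
  Poly = List Carrier

  coeff : Poly → ℕ → Carrier
  coeff []      _       = 0#
  coeff (a ∷ _) zero    = a
  coeff (_ ∷ p) (suc n) = coeff p n

  infix 4 _≈ᴾ_

  _≈ᴾ_ : Poly → Poly → Set ℓ₁
  p ≈ᴾ q = ∀ n → coeff p n ≈ coeff q n

  HasDegree : Poly → ℕ → Set (ℓ₁ ⊔ ℓ₂)
  HasDegree p n = coeff p n # 0# × (∀ m → n < m → coeff p m ≈ 0#)

  eval : Poly → Carrier → Carrier
  eval p x = foldr (λ a r → a + x * r) 0# p

  derivative : Poly → Poly
  derivative []      = []
  derivative (_ ∷ p) = go 1 p
    where
    go : ℕ → Poly → Poly
    go n []      = []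
    go n (a ∷ q) = (n ×ₙ a) ∷ go (suc n) q

  infixl 6 _+ᴾ_
  infixl 7 _*ᴾ_
  infixr 9 _∘ᴾ_

  _+ᴾ_ : Poly → Poly → Poly
  []      +ᴾ q       = q
  (a ∷ p) +ᴾ []      = a ∷ p
  (a ∷ p) +ᴾ (b ∷ q) = (a + b) ∷ (p +ᴾ q)

  _*ᴾ_ : Poly → Poly → Poly
  []      *ᴾ q = []
  (a ∷ p) *ᴾ q = map (a *_) q +ᴾ (0# ∷ (p *ᴾ q))

  -- (p ∘ᴾ q)(z) = p(q(z)), as a polynomial (Horner's scheme in F[z]).
  _∘ᴾ_ : Poly → Poly → Poly
  p ∘ᴾ q = foldr (λ a r → (a ∷ []) +ᴾ q *ᴾ r) [] p

  CriticalPoint : Poly → Pred Carrier ℓ₁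
  CriticalPoint f α = eval (derivative f) α ≈ 0#

  Orbit : Poly → Carrier → Pred Carrier ℓ₁
  Orbit f α x = ∃[ n ] x ≈ iterate (eval f) α n

  Finite : ∀ {ℓ} → Pred Carrier ℓ → Set (c ⊔ ℓ₁ ⊔ ℓ)
  Finite P = ∃[ xs ] (∀ x → P x ⇔ x ∈ xs)

  -- All critical points in F itself are meant, so this is the notion of the
  -- literature when F is algebraically closed.
  PostcriticallyFinite : Poly → Set (c ⊔ ℓ₁)
  PostcriticallyFinite f = ∀ α → CriticalPoint f α → Finite (Orbit f α)

  -- The library inverts α - 0#, which is equal to α.
  inverse : ∀ {α} → α # 0# → Carrier
  inverse α#0 = proj₁ (#⇒invertible α#0)

  affine : Carrier → Carrier → Poly
  affine α β = β ∷ α ∷ []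

  -- The inverse of αz + β is α⁻¹z - α⁻¹β.
  affine⁻¹ : ∀ {α} → α # 0# → Carrier → Poly
  affine⁻¹ α#0 β = affine (inverse α#0) (- (inverse α#0 * β))

  Conjugate : Poly → Poly → Set (c ⊔ ℓ₁ ⊔ ℓ₂)
  Conjugate f g = ∃[ α ] ∃[ β ] Σ (α # 0#) λ α#0 →
    g ≈ᴾ affine α β ∘ᴾ f ∘ᴾ affine⁻¹ α#0 β

module ℚ[z] = Polynomials ℚ.heytingField

-- The library has no algebraic closure of ℚ, so it is described by its defining
-- property, which determines it up to isomorphism. Decidability of _#_ makes the
-- underlying Heyting field a field in the usual sense, with decidable equality.
record AlgebraicClosureOfℚ c ℓ₁ ℓ₂ : Set (lsuc (c ⊔ ℓ₁ ⊔ ℓ₂)) where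
  field
    heytingField : HeytingField c ℓ₁ ℓ₂

  open HeytingField heytingField public
  open CommutativeRing (HeytingCommutativeRing.commutativeRing heytingCommutativeRing)
    public using (rawRing)
  open Polynomials heytingField public

  field
    _#?_             : Decidable _#_
    ι                : ℚ → Carrier
    ι-isHomomorphism : IsRingHomomorphism +-*-rawRing rawRing ι

  embed : ℚ[z].Poly → Poly
  embed = map ι

  field
    algebraicallyClosed : ∀ p n → HasDegree p (suc n) → ∃[ x ] eval p x ≈ 0#
    algebraic           : ∀ x → ∃[ p ] ∃[ n ] ℚ[z].HasDegree p n × eval (embed p) x ≈ 0#

-- cubic a b c d is az³ + bz² + cz + d.
cubic : ℚ → ℚ → ℚ → ℚ → ℚ[z].Poly
cubic a b c d = d ∷ c ∷ b ∷ a ∷ []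

representatives : Vec ℚ[z].Poly 15
representatives =
  cubic ( 1 /  1) ( 0 / 1) ( 0 / 1) ( 0 / 1) ∷
  cubic (-1 /  1) ( 0 / 1) ( 0 / 1) ( 1 / 1) ∷
  cubic (-2 /  1) ( 3 / 1) ( 0 / 1) ( 1 / 2) ∷
  cubic (-2 /  1) ( 3 / 1) ( 0 / 1) ( 0 / 1) ∷
  cubic (-1 /  1) ( 3 / 2) ( 0 / 1) ( 1 / 1) ∷
  cubic ( 2 /  1) (-3 / 1) ( 0 / 1) ( 1 / 1) ∷
  cubic ( 2 /  1) (-3 / 1) ( 0 / 1) ( 1 / 2) ∷
  cubic ( 1 /  1) (-3 / 2) ( 0 / 1) ( 0 / 1) ∷
  cubic (-3 /  1) ( 9 / 2) ( 0 / 1) ( 0 / 1) ∷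
  cubic (-4 /  1) ( 6 / 1) ( 0 / 1) (-1 / 2) ∷
  cubic ( 4 /  1) (-6 / 1) ( 0 / 1) ( 3 / 2) ∷
  cubic ( 3 /  1) (-9 / 2) ( 0 / 1) ( 1 / 1) ∷
  cubic (-1 /  1) ( 3 / 2) ( 0 / 1) (-1 / 1) ∷
  cubic (-1 /  4) ( 0 / 1) ( 3 / 2) ( 2 / 1) ∷
  cubic (-1 / 28) ( 0 / 1) (-3 / 4) ( 7 / 2) ∷
  []

-- A cubic with leading coefficient a can be written h + a (z - h)³ - 3aΔ (z - h) + D.
-- Its conjugacy class is determined by A = aΔ and e = aD², and its critical orbits are
-- h ± √Δ u + D v, where (u , v) runs through an orbit of a map on ℚ² depending only on A
-- and e. If both critical orbits are finite, then (A u² , e v²) takes finitely many values,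
-- so no size function can increase along it. At every prime p the p-adic size increases
-- as soon as it is large; applied to the first iterate this shows that 4A and 16e are
-- integers. The real size increases as soon as it is large too, whence |A| < 3/2 and
-- |e| < 75/8. Of the finitely many remaining pairs (A , e) all but fifteen become large,
-- over the reals or 2-adically, within three steps.

module Submission where

open import Defs
open import Algebra.Apartness.Bundles using (HeytingCommutativeRing)
open import Algebra.Bundles using (CommutativeRing)
import Algebra.Morphism.Construct.Identity as Identity
open import Algebra.Morphism.Structures using (IsRingHomomorphism)
import Algebra.Solver.Ring as RingSolver
open import Algebra.Solver.Ring.AlmostCommutativeRing using (AlmostCommutativeRing; fromCommutativeRing; _-Raw-AlmostCommutative⟶_)
open import Data.Empty using (⊥; ⊥-elim)
open import Data.Fin.Base as Fin using (Fin; toℕ; combine)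
open import Data.Fin.Properties as Fin using (any?; all?; pigeonhole; combine-injective)
open import Data.Integer.Base as ℤ using (ℤ; +_; -[1+_])
import Data.Integer.Properties as ℤ
open import Data.List.Base as List using (List; []; _∷_; map; length; applyUpTo; drop)
open import Data.List.Membership.Setoid.Properties using (∈-resp-≈; ∈-applyUpTo⁺; ∈-applyUpTo⁻)
open import Data.List.Relation.Unary.All using ([]; _∷_)
open import Data.List.Relation.Unary.Any using (index)
open import Data.List.Relation.Unary.Any.Properties using (lookup-index)
open import Data.Maybe.Base using (Maybe; just; nothing)
open import Data.Nat.Base as ℕ using (ℕ; zero; suc)
import Data.Nat.Coprimality as Coprimality
open import Data.Nat.Divisibility using (_∣_; _∣?_; ∣m⇒∣m*n; m∣m*n; ∣1⇒≡1)
open import Data.Nat.GeneralisedArithmetic using (iterate)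
open import Data.Nat.Primality using (Prime; prime?; euclidsLemma; ¬prime[1])
open import Data.Nat.Primality.Factorisation using (factorise)
import Data.Nat.Properties as ℕ
open import Data.Product.Base using (∃-syntax; _×_; _,_; proj₁; proj₂)
open import Data.Rational.Base as ℚ using (ℚ; 0ℚ; 1ℚ; +-*-rawRing; _/_)
open import Data.Rational.Literals using (fromℤ)
import Data.Rational.Properties as ℚ
open import Data.Sign.Base using (Sign)
open import Data.Sum.Base using (_⊎_; inj₁; inj₂; [_,_]′)
open import Data.Vec.Base as Vec using (Vec; []; _∷_; lookup)
open import Data.Vec.Properties using (lookup-map)
open import Function.Base using (_∘_; id; const)
open import Function.Bundles using (mk⇔; Equivalence)
open import Level using (0ℓ; _⊔_) renaming (suc to lsuc)
open import Relation.Binary.Core using (Rel)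
open import Relation.Binary.Definitions using (Transitive; Total; Decidable; tri<; tri≈; tri>)
open import Relation.Binary.PropositionalEquality as ≡ using (_≡_; _≢_)
open import Relation.Nullary using (¬_; Dec; yes; no; contradiction; ¬?; _×-dec_; _⊎-dec_)
open import Relation.Nullary.Decidable using (toWitness)
open import Relation.Unary using (Pred)

-- Conjugation by αz + β turns (a, h, Δ, D) into (a/α², αh + β, α²Δ, αD), so aΔ and aD² do not
-- change; conversely, over an algebraically closed field, equal invariants allow a scaling α with
-- α² = a/a′ and αD = D′. The obstacle is that the critical points involve √Δ, while absolute values
-- are at hand only on ℚ. Hence no element of a quadratic extension is ever measured. Multiplied by
-- √a, the displacements of the two critical orbits from h are √e v ± √A u. Their p-adic size is
-- read off from their product and the sum of their squares, which are rational; A u² and e v²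
-- themselves may differ from that size by powers of 2 at the prime 2. Over the reals A and e may be
-- negative, and |A| u² + |e| v² serves for all four sign patterns.

fromℕ : ℕ → ℚ
fromℕ n = fromℤ (+ n)

-- Polynomial identities with rational constants over a ℚ-algebra.

module ℚ-AlgebraSolver {c ℓ} (K : CommutativeRing c ℓ) (ι : ℚ → CommutativeRing.Carrier K)
  (ι-isHomomorphism : IsRingHomomorphism +-*-rawRing (CommutativeRing.rawRing K) ι) where

  open CommutativeRing K using (_≈_; reflexive)
  open IsRingHomomorphism ι-isHomomorphism

  private
    K′ : AlmostCommutativeRing c ℓ
    K′ = fromCommutativeRing K

    structureMap : +-*-rawRing -Raw-AlmostCommutative⟶ K′
    structureMap = record
      { ⟦_⟧ = ι ; +-homo = +-homo ; *-homo = *-homo ; -‿homo = -‿homo ; 0-homo = 0#-homo ; 1-homo = 1#-homo }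

    _ι≟_ : (x y : ℚ) → Maybe (ι x ≈ ι y)
    x ι≟ y with x ℚ.≟ y
    ... | yes x≡y = just (reflexive (≡.cong ι x≡y))
    ... | no _    = nothing

  open RingSolver +-*-rawRing K′ structureMap _ι≟_ public

  infix 10 #_

  #_ : ∀ {n} → ℕ → Polynomial n
  # n = con (fromℕ n)

±_ : Sign → ℚ
± Sign.+ = fromℤ (+ 1)
± Sign.- = fromℤ -[1+ 0 ]

-- The map on states that describes both critical orbits.

module CriticalDynamics {c ℓ} (K : CommutativeRing c ℓ) (ι : ℚ → CommutativeRing.Carrier K)
  (ι-isHomomorphism : IsRingHomomorphism +-*-rawRing (CommutativeRing.rawRing K) ι) where

  open CommutativeRing K
  open import Algebra.Properties.Ring ring using (-0#≈0#)
  open IsRingHomomorphism ι-isHomomorphism using (0#-homo)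
  open ℚ-AlgebraSolver K ι ι-isHomomorphism

  ⌜_⌝ : ℕ → Carrier
  ⌜ n ⌝ = ι (fromℕ n)

  module Orbit (A e : Carrier) where

    State : Set c
    State = Carrier × Carrier

    -- With X = √e v + √A u and Y = √e v - √A u one has N = XY, R = X² + Y² and
    -- W = √e (X + Y), and step is X ↦ X³ - 3AX + √e, Y ↦ Y³ - 3AY + √e.
    P Q N R W : State → Carrier
    P (u , v) = A * (u * u)
    Q (u , v) = e * (v * v)
    N s = Q s - P s
    R s = ⌜ 2 ⌝ * (P s + Q s)
    W (u , v) = ⌜ 2 ⌝ * (e * v)

    step : State → State
    step s@(u , v) = u * (P s + ⌜ 3 ⌝ * Q s - ⌜ 3 ⌝ * A) , v * (⌜ 3 ⌝ * P s + Q s - ⌜ 3 ⌝ * A) + ⌜ 1 ⌝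

    orbit : ℕ → State
    orbit zero    = ⌜ 1 ⌝ , ⌜ 0 ⌝
    orbit (suc n) = step (orbit n)

    -- Only `P` and `Q` are required to repeat: they can be recovered from the two critical orbits
    -- even when A or e is 0, whereas `u` or `v` then leaves no trace in them. A repetition beyond
    -- every `n` is needed because growth may set in only at a later state.
    Recurrent : Set ℓ
    Recurrent = ∀ n → ∃[ i ] ∃[ k ] P (orbit (i ℕ.+ n)) ≈ P (orbit (suc k ℕ.+ (i ℕ.+ n)))
                                  × Q (orbit (i ℕ.+ n)) ≈ Q (orbit (suc k ℕ.+ (i ℕ.+ n)))

    -- From the first escaping state on, the orbit is a strict chain for `_⊏_`, so two later states
    -- with the same `P` and `Q` cannot occur. The relation is left abstract to serve both the
    -- p-adic and the real size.
    growing⇒¬recurrent : ∀ {a r} {Escaping : Pred State a} {_⊏_ : Rel State r} → Transitive _⊏_ →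
      (∀ s → Escaping s → s ⊏ step s × Escaping (step s)) →
      (∀ s t → P s ≈ P t → Q s ≈ Q t → ¬ (s ⊏ t)) →
      Recurrent → ∀ n → ¬ Escaping (orbit n)
    growing⇒¬recurrent {Escaping = Escaping} {_⊏_} ⊏-trans grow irrefl recurrent n escaping
      with i , k , P≈ , Q≈ ← recurrent n =
      irrefl _ _ P≈ Q≈ (proj₁ (later (i ℕ.+ n) (escapes i) k))
      where
      escapes : ∀ i → Escaping (orbit (i ℕ.+ n))
      escapes zero    = escaping
      escapes (suc i) = proj₂ (grow _ (escapes i))
      later : ∀ m → Escaping (orbit m) → ∀ k → orbit m ⊏ orbit (suc k ℕ.+ m) × Escaping (orbit (suc k ℕ.+ m))
      later m esc zero    = grow _ esc
      later m esc (suc k) with lt , esc′ ← later m esc k with lt′ , esc″ ← grow _ esc′ = ⊏-trans lt lt′ , esc″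

    -- The remainders of N ∘ step and R ∘ step below their leading terms.
    N-tail R-tail : State → Carrier
    N-tail s = - (⌜ 3 ⌝ * A) * (N s * R s) + ((R s - N s) * W s
             + (- (⌜ 3 ⌝ * A) * (- (⌜ 3 ⌝ * A) * N s) + (- (⌜ 3 ⌝ * A) * W s + e)))
    R-tail s = - (⌜ 3 ⌝ * A) * (⌜ 2 ⌝ * (R s * R s) - ⌜ 4 ⌝ * (N s * N s)) + (⌜ 2 ⌝ * (R s - N s) * W s
             + (- (⌜ 3 ⌝ * A) * (- (⌜ 3 ⌝ * A) * R s) + (- (⌜ 3 ⌝ * A) * (⌜ 2 ⌝ * W s) + ⌜ 2 ⌝ * e)))

    module Poly {n} (A e u v : Polynomial n) where
      P′ = A :* (u :* u)
      Q′ = e :* (v :* v)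
      N′ = Q′ :- P′
      R′ = # 2 :* (P′ :+ Q′)
      W′ = # 2 :* (e :* v)
      u′ = u :* (P′ :+ # 3 :* Q′ :- # 3 :* A)
      v′ = v :* (# 3 :* P′ :+ Q′ :- # 3 :* A) :+ # 1
      c′ = :- (# 3 :* A)

    -- With c = -3A this expands (X³ + cX + √e)(Y³ + cY + √e). The odd terms combine with √e into
    -- `W`, since √e (X³ + Y³) = √e (X + Y)(X² - XY + Y²) = W (R - N).
    N-step : ∀ s → N (step s) ≈ N s * (N s * N s) + N-tail s
    N-step (u , v) = solve 4 (λ A e u v → let open Poly A e u v in
      e :* (v′ :* v′) :- A :* (u′ :* u′) :=
      N′ :* (N′ :* N′) :+ (c′ :* (N′ :* R′) :+ ((R′ :- N′) :* W′ :+ (c′ :* (c′ :* N′) :+ (c′ :* W′ :+ e)))))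
      refl A e u v

    -- Here X⁶ + Y⁶ = R³ - 3N²R. The term 3N²R stands on the left because it is small only when `N`
    -- is, so it is kept apart from the tail.
    R-step : ∀ s → R (step s) + ⌜ 3 ⌝ * (N s * (N s * R s)) ≈ R s * (R s * R s) + R-tail s
    R-step (u , v) = solve 4 (λ A e u v → let open Poly A e u v in
      # 2 :* (A :* (u′ :* u′) :+ e :* (v′ :* v′)) :+ # 3 :* (N′ :* (N′ :* R′)) :=
      R′ :* (R′ :* R′) :+ (c′ :* (# 2 :* (R′ :* R′) :- # 4 :* (N′ :* N′)) :+ (# 2 :* (R′ :- N′) :* W′
        :+ (c′ :* (c′ :* R′) :+ (c′ :* (# 2 :* W′) :+ # 2 :* e)))))
      refl A e u v

    -- `W` is not a function of `N` and `R`; its size is controlled through W² = e (X + Y)².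
    W² : ∀ s → W s * W s ≈ e * (R s + ⌜ 2 ⌝ * N s)
    W² (u , v) = solve 4 (λ A e u v → let open Poly A e u v in W′ :* W′ := e :* (R′ :+ # 2 :* N′)) refl A e u v

    -- The first iterate is (u, v) = (-2A, 1), where P = 4A³ and Q = e, and in general R + 2N = 4Q
    -- and R - 2N = 4P. The factors 4 and 16 arising here are the source of the denominators allowed
    -- for A and e.
    first-R+2N : R (orbit 1) + ⌜ 2 ⌝ * N (orbit 1) ≈ ⌜ 4 ⌝ * e
    first-R+2N = solve 2 (λ A e → let open Poly A e (Poly.u′ A e (# 1) (# 0)) (Poly.v′ A e (# 1) (# 0)) in
      R′ :+ # 2 :* N′ := # 4 :* e) refl A e

    first-R-2N : R (orbit 1) - ⌜ 2 ⌝ * N (orbit 1) ≈ ⌜ 16 ⌝ * (A * (A * A))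
    first-R-2N = solve 2 (λ A e → let open Poly A e (Poly.u′ A e (# 1) (# 0)) (Poly.v′ A e (# 1) (# 0)) in
      R′ :- # 2 :* N′ := # 16 :* (A :* (A :* A))) refl A e

  -- Growth for a non-archimedean absolute value, of which only the comparison |x| ≤ |y| is used.

  record ValuationPreorder r : Set (c ⊔ ℓ ⊔ lsuc r) where
    infix 4 _≼_ _≼?_
    field
      _≼_         : Rel Carrier r
      ≼-reflexive : ∀ {x y} → x ≈ y → x ≼ y
      ≼-trans     : Transitive _≼_
      ≼-total     : Total _≼_
      _≼?_        : Decidable _≼_
      ≼-+         : ∀ {x y z} → x ≼ z → y ≼ z → x + y ≼ z
      ≼-*         : ∀ {x y z w} → x ≼ y → z ≼ w → x * z ≼ y * w
      ≼-*-cancelʳ : ∀ {x y z} → ¬ z ≈ 0# → x * z ≼ y * z → x ≼ y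
      integers≼1  : ∀ i → ι (fromℤ i) ≼ 1#

  module NonArchimedean {r} (valuationPreorder : ValuationPreorder r) where

    open ValuationPreorder valuationPreorder

    infix 4 _≺_

    _≺_ : Rel Carrier r
    x ≺ y = ¬ (y ≼ x)

    ≼-refl : ∀ {x} → x ≼ x
    ≼-refl = ≼-reflexive refl

    0≼ : ∀ {x} → 0# ≼ x
    0≼ {x} = ≼-trans (≼-reflexive (sym (zeroˡ x)))
      (≼-trans (≼-* (≼-trans (≼-reflexive (sym 0#-homo)) (integers≼1 (+ 0))) ≼-refl) (≼-reflexive (*-identityˡ x)))

    ≺⇒≼ : ∀ {x y} → x ≺ y → x ≼ y
    ≺⇒≼ {x} {y} x≺y = [ id , (λ y≼x → contradiction y≼x x≺y) ]′ (≼-total x y)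

    ≼-≺-trans : ∀ {x y z} → x ≼ y → y ≺ z → x ≺ z
    ≼-≺-trans x≼y y≺z z≼x = y≺z (≼-trans z≼x x≼y)

    ≺-≼-trans : ∀ {x y z} → x ≺ y → y ≼ z → x ≺ z
    ≺-≼-trans x≺y y≼z z≼x = x≺y (≼-trans y≼z z≼x)

    ≺⇒≉0 : ∀ {x y} → x ≺ y → ¬ y ≈ 0#
    ≺⇒≉0 x≺y y≈0 = x≺y (≼-trans (≼-reflexive y≈0) 0≼)

    ≺-+ : ∀ {x y z} → x ≺ z → y ≺ z → x + y ≺ z
    ≺-+ {x} {y} x≺z y≺z = [ (λ x≼y → ≼-≺-trans (≼-+ x≼y ≼-refl) y≺z)
                          , (λ y≼x → ≼-≺-trans (≼-+ ≼-refl y≼x) x≺z) ]′ (≼-total x y)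

    ≺-*-≼ : ∀ {x y z w} → x ≺ y → z ≼ w → ¬ w ≈ 0# → x * z ≺ y * w
    ≺-*-≼ x≺y z≼w w≉0 yw≼xz = x≺y (≼-*-cancelʳ w≉0 (≼-trans yw≼xz (≼-* ≼-refl z≼w)))

    ≼-*-≺ : ∀ {x y z w} → x ≼ y → ¬ y ≈ 0# → z ≺ w → x * z ≺ y * w
    ≼-*-≺ {x} {y} {z} {w} x≼y y≉0 z≺w yw≼xz = ≺-*-≼ z≺w x≼y y≉0
      (≼-trans (≼-reflexive (*-comm w y)) (≼-trans yw≼xz (≼-reflexive (*-comm x z))))

    ≺-* : ∀ {x y z w} → x ≺ y → z ≺ w → x * z ≺ y * w
    ≺-* x≺y z≺w = ≺-*-≼ x≺y (≺⇒≼ z≺w) (≺⇒≉0 z≺w)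

    integer-* : ∀ i {x y} → x ≼ y → ι (fromℤ i) * x ≼ y
    integer-* i {y = y} x≼y = ≼-trans (≼-* (integers≼1 i) x≼y) (≼-reflexive (*-identityˡ y))

    neg-≼ : ∀ {x y} → x ≼ y → - x ≼ y
    neg-≼ {x} x≼y = ≼-trans (≼-reflexive (solve 1 (λ x → :- x := con (fromℤ -[1+ 0 ]) :* x) refl x)) (integer-* -[1+ 0 ] x≼y)

    square≼1 : ∀ x → x * x ≼ 1# → x ≼ 1#
    square≼1 x x²≼1 with x ≼? 1#
    ... | yes x≼1 = x≼1
    ... | no  1≺x = contradiction x²≼1 (≼-≺-trans (≼-reflexive (sym (*-identityˡ 1#))) (≺-* 1≺x 1≺x))

    cube≼1 : ∀ x → x * (x * x) ≼ 1# → x ≼ 1#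
    cube≼1 x x³≼1 with x ≼? 1#
    ... | yes x≼1 = x≼1
    ... | no  1≺x = contradiction x³≼1 (≼-≺-trans
      (≼-reflexive (sym (trans (*-identityˡ _) (*-identityˡ 1#)))) (≺-* 1≺x (≺-* 1≺x 1≺x)))

    module _ (A e : Carrier) where

      open Orbit A e

      -- max (|X|², |Y|²) is the larger of |XY| and |X² + Y²|.
      size : State → Carrier
      size s = [ const (R s) , const (N s) ]′ (≼-total (N s) (R s))

      N≼size : ∀ s → N s ≼ size s
      N≼size s with ≼-total (N s) (R s)
      ... | inj₁ N≼R = N≼R
      ... | inj₂ _   = ≼-refl

      R≼size : ∀ s → R s ≼ size s
      R≼size s with ≼-total (N s) (R s)
      ... | inj₁ _   = ≼-refl
      ... | inj₂ R≼N = R≼N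

      size-attained : ∀ s → size s ≼ N s ⊎ size s ≼ R s
      size-attained s with ≼-total (N s) (R s)
      ... | inj₁ _ = inj₂ ≼-refl
      ... | inj₂ _ = inj₁ ≼-refl

      -- With |X|² = T these conditions say that X³ dominates X³ - 3AX + √e: |A| < T means |AX| <
      -- |X|³, and |e| < T³ is the square of |√e| < |X|³. The condition 1 < T makes the cube larger
      -- than X.
      Escaping : State → Set r
      Escaping s = 1# ≺ size s × A ≺ size s × e ≺ size s * (size s * size s)

      module _ (s : State) (escaping : Escaping s) where

        private
          T = size s
          T³ = T * (T * T)
          1≺T = proj₁ escaping
          e≺T³ = proj₂ (proj₂ escaping)

          T≉0 : ¬ T ≈ 0#
          T≉0 = ≺⇒≉0 1≺T

          c≺T : - (⌜ 3 ⌝ * A) ≺ T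
          c≺T = ≼-≺-trans (neg-≼ (integer-* (+ 3) ≼-refl)) (proj₁ (proj₂ escaping))

          R+2N≼T : R s + ⌜ 2 ⌝ * N s ≼ T
          R+2N≼T = ≼-+ (R≼size s) (integer-* (+ 2) (N≼size s))

          R-N≼T : R s - N s ≼ T
          R-N≼T = ≼-+ (R≼size s) (neg-≼ (N≼size s))

          W≺T² : W s ≺ T * T
          -- If T² ≼ W, then T⁴ ≼ W² = e (R + 2N), while e ≺ T³ and R + 2N ≼ T make the right side
          -- smaller than T⁴.
          W≺T² T²≼W = ≺-*-≼ e≺T³ R+2N≼T T≉0
            (≼-trans (≼-reflexive (solve 1 (λ T → T :* (T :* T) :* T := T :* T :* (T :* T)) refl T))
              (≼-trans (≼-* T²≼W T²≼W) (≼-reflexive (W² s))))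

          T²≉0 : ¬ T * T ≈ 0#
          T²≉0 = ≺⇒≉0 W≺T²

          N-tail≺T³ : N-tail s ≺ T³
          N-tail≺T³ =
            ≺-+ (≺-*-≼ c≺T (≼-* (N≼size s) (R≼size s)) T²≉0)
            (≺-+ (≼-*-≺ R-N≼T T≉0 W≺T²)
            (≺-+ (≺-* c≺T (≺-*-≼ c≺T (N≼size s) T≉0))
            (≺-+ (≺-* c≺T W≺T²) e≺T³)))

          R-tail≺T³ : R-tail s ≺ T³
          R-tail≺T³ =
            ≺-+ (≺-*-≼ c≺T (≼-+ (integer-* (+ 2) (≼-* (R≼size s) (R≼size s)))
                                (neg-≼ (integer-* (+ 4) (≼-* (N≼size s) (N≼size s))))) T²≉0)
            (≺-+ (≼-*-≺ (integer-* (+ 2) R-N≼T) T≉0 W≺T²)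
            (≺-+ (≺-* c≺T (≺-*-≼ c≺T (R≼size s) T≉0))
            (≺-+ (≺-* c≺T (≼-≺-trans (integer-* (+ 2) ≼-refl) W≺T²))
                 (≼-≺-trans (integer-* (+ 2) ≼-refl) e≺T³))))

        -- `T` is attained by `N s` or by `R s`. In the first case N³ has the full size T³ and the
        -- tail of `N-step` is smaller. Otherwise `N s ≺ T`, so 3N²R is smaller than T³ as well and
        -- R³ dominates `R-step`. An image of size below T³ would thus make N³ or R³ smaller than
        -- T³, a contradiction.
        size-step : T³ ≼ size (step s)
        size-step with T³ ≼? size (step s)
        ... | yes T³≼T′ = T³≼T′
        ... | no  T′≺T³ = ⊥-elim (impossible (T ≼? N s) (size-attained s))
          where
          N³≺T³ : N s * (N s * N s) ≺ T³
          N³≺T³ = ≼-≺-trans (≼-reflexive (subtract (N-step s)))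
            (≺-+ (≼-≺-trans (N≼size (step s)) T′≺T³) (≼-≺-trans (neg-≼ ≼-refl) N-tail≺T³))
            where
            subtract : ∀ {x y z} → x ≈ y + z → y ≈ x - z
            subtract {x} {y} {z} x≈y+z = trans (solve 2 (λ y z → y := y :+ z :- z) refl y z) (+-congʳ (sym x≈y+z))

          R³≺T³ : N s ≺ T → R s * (R s * R s) ≺ T³
          R³≺T³ N≺T = ≼-≺-trans (≼-reflexive (subtract (R-step s)))
            (≺-+ (≼-≺-trans (R≼size (step s)) T′≺T³)
            (≺-+ (≼-≺-trans (integer-* (+ 3) ≼-refl) (≺-*-≼ N≺T (≼-* (N≼size s) (R≼size s)) T²≉0))
                 (≼-≺-trans (neg-≼ ≼-refl) R-tail≺T³)))
            where
            subtract : ∀ {x w y z} → x + w ≈ y + z → y ≈ x + (w - z)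
            subtract {x} {w} {y} {z} eq = trans (solve 2 (λ y z → y := y :+ z :- z) refl y z)
              (trans (+-congʳ (sym eq)) (+-assoc x w (- z)))

          impossible : Dec (T ≼ N s) → T ≼ N s ⊎ T ≼ R s → ⊥
          impossible (yes T≼N) _          = N³≺T³ (≼-* T≼N (≼-* T≼N T≼N))
          impossible (no  N≺T) (inj₁ T≼N) = N≺T T≼N
          impossible (no  N≺T) (inj₂ T≼R) = R³≺T³ N≺T (≼-* T≼R (≼-* T≼R T≼R))

        size-grows : T ≺ size (step s)
        size-grows = ≺-≼-trans
          (≼-≺-trans (≼-reflexive (sym (trans (*-identityˡ _) (*-identityˡ T))))
            (≺-*-≼ 1≺T (≼-* (≺⇒≼ 1≺T) ≼-refl) T²≉0)) size-step

      escaping-step : ∀ s → Escaping s → size s ≺ size (step s) × Escaping (step s)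
      escaping-step s escaping@(1≺T , A≺T , e≺T³) =
        T≺T′ , ≺-≼-trans 1≺T (≺⇒≼ T≺T′) , ≺-≼-trans A≺T (≺⇒≼ T≺T′) ,
        ≺-≼-trans e≺T³ (≼-* (≺⇒≼ T≺T′) (≼-* (≺⇒≼ T≺T′) (≺⇒≼ T≺T′)))
        where T≺T′ = size-grows s escaping

      size-cong : ∀ s t → P s ≈ P t → Q s ≈ Q t → size t ≼ size s
      size-cong s t P≈ Q≈ =
        [ (λ T≼N → ≼-trans T≼N (≼-trans (≼-reflexive (+-cong (sym Q≈) (-‿cong (sym P≈)))) (N≼size s)))
        , (λ T≼R → ≼-trans T≼R (≼-trans (≼-reflexive (*-congˡ (+-cong (sym P≈) (sym Q≈)))) (R≼size s))) ]′
        (size-attained t)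

      module _ (recurrent : Recurrent) where

        ¬escaping : ∀ n → ¬ Escaping (orbit n)
        ¬escaping = growing⇒¬recurrent {_⊏_ = λ s t → size s ≺ size t}
          (λ x≺y y≺z → ≼-≺-trans (≺⇒≼ x≺y) y≺z) escaping-step (λ s t P≈ Q≈ → contradiction (size-cong s t P≈ Q≈)) recurrent

        private
          T = size (orbit 1)

          4·e≼T : ⌜ 4 ⌝ * e ≼ T
          4·e≼T = ≼-trans (≼-reflexive (sym first-R+2N)) (≼-+ (R≼size (orbit 1)) (integer-* (+ 2) (N≼size (orbit 1))))

          16A³≼T : ⌜ 16 ⌝ * (A * (A * A)) ≼ T
          16A³≼T = ≼-trans (≼-reflexive (sym first-R-2N)) (≼-+ (R≼size (orbit 1)) (neg-≼ (integer-* (+ 2) (N≼size (orbit 1)))))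

          -- The first iterate does not escape, so one of the three conditions of `Escaping` fails
          -- there; each failure bounds A and e through 16A³ ≼ T and 4e ≼ T.
          bounds : Dec (T ≼ 1#) → Dec (T ≼ A) → Dec (T * (T * T) ≼ e) → ⌜ 4 ⌝ * A ≼ 1# × ⌜ 16 ⌝ * e ≼ 1#
          bounds (yes T≼1) _ _ =
            cube≼1 _ (≼-trans (≼-reflexive (solve 1 (λ A → # 4 :* A :* (# 4 :* A :* (# 4 :* A)) := # 4 :* (# 16 :* (A :* (A :* A)))) refl A))
              (integer-* (+ 4) (≼-trans 16A³≼T T≼1))) ,
            ≼-trans (≼-reflexive (solve 1 (λ e → # 16 :* e := # 4 :* (# 4 :* e)) refl e)) (integer-* (+ 4) (≼-trans 4·e≼T T≼1))
          bounds (no 1≺T) (yes T≼A) _ = 4A≼1 ,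
            ≼-trans (≼-reflexive (solve 1 (λ e → # 16 :* e := # 4 :* (# 4 :* e)) refl e))
              (≼-trans (≼-* ≼-refl (≼-trans 4·e≼T T≼A)) 4A≼1)
            where
            -- From 16A³ ≼ T ≼ A follows (4A)² A ≼ A, and A may be cancelled because 1 ≺ T ≼ A makes
            -- it nonzero.
            4A≼1 = square≼1 _ (≼-*-cancelʳ (≺⇒≉0 (≺-≼-trans 1≺T T≼A))
              (≼-trans (≼-reflexive (solve 1 (λ A → # 4 :* A :* (# 4 :* A) :* A := # 16 :* (A :* (A :* A))) refl A))
                (≼-trans 16A³≼T (≼-trans T≼A (≼-reflexive (sym (*-identityˡ A)))))))
          bounds (no 1≺T) (no _) (yes T³≼e) =
            -- (4A)⁹ = 8 · 8 · (16A³)³ and (16A³)³ ≼ T³ ≼ e, so the bound 8e ≼ 1 proved below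
            -- finishes; 4A ≼ 1 follows by taking two cube roots.
            cube≼1 _ (cube≼1 _ (≼-trans
              (≼-reflexive (solve 1 (λ A → let x = # 16 :* (A :* (A :* A)); y = # 4 :* A; y³ = y :* (y :* y) in
                y³ :* (y³ :* y³) := # 8 :* (# 8 :* (x :* (x :* x)))) refl A))
              (integer-* (+ 8) (≼-trans (≼-* ≼-refl (≼-trans (≼-* 16A³≼T (≼-* 16A³≼T 16A³≼T)) T³≼e)) 8·e≼1)))) ,
            ≼-trans (≼-reflexive (solve 1 (λ e → # 16 :* e := # 2 :* (# 8 :* e)) refl e)) (integer-* (+ 2) 8·e≼1)
            where
            1≺T³ : 1# ≺ T * (T * T)
            1≺T³ T³≼1 = 1≺T (cube≼1 T T³≼1)
            -- (8e)² e = (4e)³ ≼ T³ ≼ e, which is even better than 16e ≼ 1 by a factor of 2.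
            8·e≼1 = square≼1 _ (≼-*-cancelʳ (≺⇒≉0 (≺-≼-trans 1≺T³ T³≼e))
              (≼-trans (≼-reflexive (solve 1 (λ e → let x = # 4 :* e in # 8 :* e :* (# 8 :* e) :* e := x :* (x :* x)) refl e))
                (≼-trans (≼-* 4·e≼T (≼-* 4·e≼T 4·e≼T)) (≼-trans T³≼e (≼-reflexive (sym (*-identityˡ e)))))))
          bounds (no 1≺T) (no A≺T) (no e≺T³) = contradiction (1≺T , A≺T , e≺T³) (¬escaping 1)

        parameters-integral : ⌜ 4 ⌝ * A ≼ 1# × ⌜ 16 ⌝ * e ≼ 1#
        parameters-integral = bounds (T ≼? 1#) (T ≼? A) (T * (T * T) ≼? e)

        -- If 4S is not integral for the size S of a state, that state escapes: S ≼ A would give 4S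
        -- ≼ 4A ≼ 1, and S³ ≼ e would give (4S)³ ≼ 4 · 16e ≼ 1. At the prime 2 this is the test that
        -- removes candidates in the finite search.
        orbit-integral : ∀ n → ⌜ 4 ⌝ * R (orbit n) ≼ 1# × ⌜ 4 ⌝ * N (orbit n) ≼ 1#
        orbit-integral n with ⌜ 4 ⌝ * size (orbit n) ≼? 1#
        ... | yes 4T≼1 = ≼-trans (≼-* ≼-refl (R≼size (orbit n))) 4T≼1 , ≼-trans (≼-* ≼-refl (N≼size (orbit n))) 4T≼1
        ... | no  1≺4T = contradiction (1≺T , A≺T , e≺T³) (¬escaping n)
          where
          S = size (orbit n)
          1≺T : 1# ≺ S
          1≺T = ≺-≼-trans 1≺4T (integer-* (+ 4) ≼-refl)
          A≺T : A ≺ S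
          A≺T S≼A = 1≺4T (≼-trans (≼-* ≼-refl S≼A) (proj₁ parameters-integral))
          e≺T³ : e ≺ S * (S * S)
          e≺T³ S³≼e = 1≺4T (cube≼1 _ (≼-trans
            (≼-reflexive (solve 1 (λ S → let x = # 4 :* S in x :* (x :* x) := # 4 :* (# 16 :* (S :* (S :* S)))) refl S))
            (integer-* (+ 4) (≼-trans (≼-* ≼-refl S³≼e) (proj₂ parameters-integral)))))

  -- Growth for an order given by its positive elements.

  record PositiveCone r : Set (c ⊔ ℓ ⊔ lsuc r) where
    field
      Positive   : Pred Carrier r
      pos-resp-≈ : ∀ {x y} → x ≈ y → Positive x → Positive y
      pos-+      : ∀ {x y} → Positive x → Positive y → Positive (x + y)
      pos-*      : ∀ {x y} → Positive x → Positive y → Positive (x * y)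
      trichotomy : ∀ x → Positive x ⊎ x ≈ 0# ⊎ Positive (- x)
      0-not-pos  : ¬ Positive 0#
      pos-ι      : ∀ q → 0ℚ ℚ.< q → Positive (ι q)

  module Ordered {r} (positiveCone : PositiveCone r) where

    open PositiveCone positiveCone

    NonNegative : Pred Carrier (ℓ ⊔ r)
    NonNegative x = Positive x ⊎ x ≈ 0#

    pos-+-nonNeg : ∀ {x y} → Positive x → NonNegative y → Positive (x + y)
    pos-+-nonNeg px (inj₁ py)  = pos-+ px py
    pos-+-nonNeg px (inj₂ y≈0) = pos-resp-≈ (trans (sym (+-identityʳ _)) (+-congˡ (sym y≈0))) px

    nonNeg-+-pos : ∀ {x y} → NonNegative x → Positive y → Positive (x + y)
    nonNeg-+-pos nx py = pos-resp-≈ (+-comm _ _) (pos-+-nonNeg py nx)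

    nonNeg-+ : ∀ {x y} → NonNegative x → NonNegative y → NonNegative (x + y)
    nonNeg-+ (inj₁ px)  ny         = inj₁ (pos-+-nonNeg px ny)
    nonNeg-+ (inj₂ x≈0) (inj₁ py)  = inj₁ (nonNeg-+-pos (inj₂ x≈0) py)
    nonNeg-+ (inj₂ x≈0) (inj₂ y≈0) = inj₂ (trans (+-cong x≈0 y≈0) (+-identityˡ 0#))

    nonNeg-* : ∀ {x y} → NonNegative x → NonNegative y → NonNegative (x * y)
    nonNeg-* (inj₁ px)  (inj₁ py)  = inj₁ (pos-* px py)
    nonNeg-* (inj₂ x≈0) _          = inj₂ (trans (*-congʳ x≈0) (zeroˡ _))
    nonNeg-* (inj₁ _)   (inj₂ y≈0) = inj₂ (trans (*-congˡ y≈0) (zeroʳ _))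

    nonNeg-square : ∀ x → NonNegative (x * x)
    nonNeg-square x with trichotomy x
    ... | inj₁ px          = inj₁ (pos-* px px)
    ... | inj₂ (inj₁ x≈0)  = nonNeg-* (inj₂ x≈0) (inj₂ x≈0)
    ... | inj₂ (inj₂ p-x)  = inj₁ (pos-resp-≈ (solve 1 (λ x → :- x :* :- x := x :* x) refl x) (pos-* p-x p-x))

    nonNeg-resp-≈ : ∀ {x y} → x ≈ y → NonNegative x → NonNegative y
    nonNeg-resp-≈ x≈y (inj₁ px)  = inj₁ (pos-resp-≈ x≈y px)
    nonNeg-resp-≈ x≈y (inj₂ x≈0) = inj₂ (trans (sym x≈y) x≈0)

    nonNeg-⌜⌝ : ∀ n → NonNegative ⌜ n ⌝
    nonNeg-⌜⌝ zero    = inj₂ 0#-homo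
    nonNeg-⌜⌝ (suc n) = inj₁ (pos-ι (fromℕ (suc n)) (ℚ.positive⁻¹ _))

    infix 4 _<_ _≤_

    _<_ : Rel Carrier r
    x < y = Positive (y - x)

    _≤_ : Rel Carrier (ℓ ⊔ r)
    x ≤ y = NonNegative (y - x)

    <-irrefl : ∀ {x y} → x ≈ y → ¬ (x < y)
    <-irrefl {x} x≈y x<y = 0-not-pos (pos-resp-≈ (trans (+-congʳ (sym x≈y)) (-‿inverseʳ x)) x<y)

    <-trans : ∀ {x y z} → x < y → y < z → x < z
    <-trans {x} {y} {z} x<y y<z =
      pos-resp-≈ (solve 3 (λ x y z → (y :- x) :+ (z :- y) := z :- x) refl x y z) (pos-+ x<y y<z)

    <-or-≥ : ∀ x y → x < y ⊎ y ≤ x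
    <-or-≥ x y with trichotomy (y - x)
    ... | inj₁ p        = inj₁ p
    ... | inj₂ (inj₁ z) = inj₂ (inj₂ (trans (swap x y) (trans (-‿cong z) -0#≈0#)))
      where swap = solve 2 (λ x y → x :- y := :- (y :- x)) refl
    ... | inj₂ (inj₂ p) = inj₂ (inj₁ (pos-resp-≈ (solve 2 (λ x y → :- (y :- x) := x :- y) refl x y) p))

    module _ (α β : Carrier) where

      -- |A| u² + |e| v², with A = ± α and e = ± β.
      norm : Carrier × Carrier → Carrier
      norm (u , v) = α * (u * u) + β * (v * v)

      -- Writing n for the norm, ‖C‖² - 2‖L‖² ≥ n³ - 36α²n - 4β in the notation of `gain`, and
      -- growth asks for more than 2n. With β ≤ n the term 4β costs at most 4n, so n² > 36α² + 2 + 4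
      -- suffices.
      threshold : Carrier
      threshold = ⌜ 6 ⌝ + ⌜ 36 ⌝ * (α * α)

      -- With C and L the homogeneous cubic part and the rest of step, this is
      -- ‖C + L‖² = ½‖C‖² - ‖L‖² + ½‖C + 2L‖², where ‖C‖² ≥ norm³ and ‖L‖² ≤ 18α² norm + 2β.
      gain : Sign → Sign → Carrier × Carrier → Carrier
      gain s t (u , v) =
        let p = α * (u * u)
            q = β * (v * v)
            n = p + q
            X = u * (p + ι (fromℕ 3 ℚ.* (± s ℚ.* ± t)) * q - ⌜ 6 ⌝ * α)
            Y = v * (⌜ 3 ⌝ * p + ι (± s ℚ.* ± t) * q - ⌜ 6 ⌝ * α) + ⌜ 2 ⌝ * ι (± s)
            Z = ι (± s) + ⌜ 3 ⌝ * (α * v)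
        in α * (X * X) + (β * (Y * Y) + (ι (fromℕ 6 ℚ.* (1ℚ ℚ.+ ± s ℚ.* ± t)) * (p * q * n)
         + (⌜ 18 ⌝ * (α * α * p) + (⌜ 2 ⌝ * (β * (Z * Z)) + (⌜ 4 ⌝ * (n - β) + n * (n * n - threshold))))))

      norm-step : ∀ s t x → ⌜ 2 ⌝ * (norm (Orbit.step (ι (± s) * α) (ι (± t) * β) x) - norm x) ≈ gain s t x
      norm-step s t (u , v) = identity s t
        where
        equation : Sign → Sign → (α β u v : Polynomial 4) → Polynomial 4 × Polynomial 4
        equation s t α β u v =
          let A = con (± s) :* α
              e = con (± t) :* β
              u′ = u :* (A :* (u :* u) :+ # 3 :* (e :* (v :* v)) :- # 3 :* A)
              v′ = v :* (# 3 :* (A :* (u :* u)) :+ e :* (v :* v) :- # 3 :* A) :+ # 1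
              p = α :* (u :* u)
              q = β :* (v :* v)
              n = p :+ q
              X = u :* (p :+ con (fromℕ 3 ℚ.* (± s ℚ.* ± t)) :* q :- # 6 :* α)
              Y = v :* (# 3 :* p :+ con (± s ℚ.* ± t) :* q :- # 6 :* α) :+ # 2 :* con (± s)
              Z = con (± s) :+ # 3 :* (α :* v)
          in # 2 :* ((α :* (u′ :* u′) :+ β :* (v′ :* v′)) :- n) :=
             α :* (X :* X) :+ (β :* (Y :* Y) :+ (con (fromℕ 6 ℚ.* (1ℚ ℚ.+ ± s ℚ.* ± t)) :* (p :* q :* n)
             :+ (# 18 :* (α :* α :* p) :+ (# 2 :* (β :* (Z :* Z)) :+ (# 4 :* (n :- β)
             :+ n :* (n :* n :- (# 6 :+ # 36 :* (α :* α))))))))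
        identity : ∀ s t → ⌜ 2 ⌝ * (norm (Orbit.step (ι (± s) * α) (ι (± t) * β) (u , v)) - norm (u , v)) ≈ gain s t (u , v)
        -- The identity rests on the square of each sign being 1, which the solver sees only when
        -- the signs are constants.
        identity Sign.+ Sign.+ = solve 4 (equation Sign.+ Sign.+) refl α β u v
        identity Sign.+ Sign.- = solve 4 (equation Sign.+ Sign.-) refl α β u v
        identity Sign.- Sign.+ = solve 4 (equation Sign.- Sign.+) refl α β u v
        identity Sign.- Sign.- = solve 4 (equation Sign.- Sign.-) refl α β u v

      norm-first : ∀ s t → norm (Orbit.orbit (ι (± s) * α) (ι (± t) * β) 1) ≈ ⌜ 4 ⌝ * (α * (α * α)) + β
      norm-first s t = identity s t
        where
        equation : Sign → Sign → (α β : Polynomial 2) → Polynomial 2 × Polynomial 2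
        equation s t α β =
          let A = con (± s) :* α
              e = con (± t) :* β
              u = # 1
              v = # 0
              u′ = u :* (A :* (u :* u) :+ # 3 :* (e :* (v :* v)) :- # 3 :* A)
              v′ = v :* (# 3 :* (A :* (u :* u)) :+ e :* (v :* v) :- # 3 :* A) :+ # 1
          in α :* (u′ :* u′) :+ β :* (v′ :* v′) := # 4 :* (α :* (α :* α)) :+ β
        identity : ∀ s t → norm (Orbit.orbit (ι (± s) * α) (ι (± t) * β) 1) ≈ ⌜ 4 ⌝ * (α * (α * α)) + β
        identity Sign.+ Sign.+ = solve 2 (equation Sign.+ Sign.+) refl α β
        identity Sign.+ Sign.- = solve 2 (equation Sign.+ Sign.-) refl α β
        identity Sign.- Sign.+ = solve 2 (equation Sign.- Sign.+) refl α β
        identity Sign.- Sign.- = solve 2 (equation Sign.- Sign.-) refl α β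

      Escaping : Carrier × Carrier → Set (ℓ ⊔ r)
      Escaping x = threshold < norm x * norm x × β ≤ norm x

      module _ (0≤α : NonNegative α) (0≤β : NonNegative β) where

        private
          nonNeg-norm : ∀ x → NonNegative (norm x)
          nonNeg-norm (u , v) = nonNeg-+ (nonNeg-* 0≤α (nonNeg-square u)) (nonNeg-* 0≤β (nonNeg-square v))

          nonNeg-threshold : NonNegative threshold
          nonNeg-threshold = nonNeg-+ (nonNeg-⌜⌝ 6) (nonNeg-* (nonNeg-⌜⌝ 36) (nonNeg-square α))

          pos-norm : ∀ x → Escaping x → Positive (norm x)
          pos-norm x (big , _) with nonNeg-norm x
          ... | inj₁ pos = pos
          ... | inj₂ z   = ⊥-elim (0-not-pos (pos-resp-≈
            (trans (solve 2 (λ a b → (b :- a) :+ a := b) refl threshold _) (trans (*-congʳ z) (zeroˡ _)))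
            (pos-+-nonNeg big nonNeg-threshold)))

          half-pos : ∀ {x} → Positive (⌜ 2 ⌝ * x) → Positive x
          half-pos {x} 2x>0 = pos-resp-≈ (solve 1 (λ x → con ℚ.½ :* (# 2 :* x) := x) refl x)
            (pos-* (pos-ι ℚ.½ (ℚ.positive⁻¹ _)) 2x>0)

          -- This is the coefficient in ‖C‖² = n³ + 6(1 + ε)pqn, where ε is the product of the
          -- signs: 12 for equal signs and 0 for opposite ones, where ‖C‖² is exactly n³.
          nonNeg-crossTerm : ∀ s t → NonNegative (ι (fromℕ 6 ℚ.* (1ℚ ℚ.+ ± s ℚ.* ± t)))
          nonNeg-crossTerm Sign.+ Sign.+ = nonNeg-⌜⌝ 12
          nonNeg-crossTerm Sign.+ Sign.- = nonNeg-⌜⌝ 0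
          nonNeg-crossTerm Sign.- Sign.+ = nonNeg-⌜⌝ 0
          nonNeg-crossTerm Sign.- Sign.- = nonNeg-⌜⌝ 12

        -- Every summand of `gain` is nonnegative, 4(n - β) by the second condition of `Escaping`;
        -- the last one, n(n² - threshold), is positive by the first.
        norm-grows : ∀ s t x → Escaping x → norm x < norm (Orbit.step (ι (± s) * α) (ι (± t) * β) x)
        norm-grows s t x@(u , v) escaping@(big , β≤norm) = half-pos (pos-resp-≈ (sym (norm-step s t x))
          (nonNeg-+-pos (nonNeg-* 0≤α (nonNeg-square _))
          (nonNeg-+-pos (nonNeg-* 0≤β (nonNeg-square _))
          (nonNeg-+-pos (nonNeg-* (nonNeg-crossTerm s t) (nonNeg-* (nonNeg-* 0≤p 0≤q) (nonNeg-norm x)))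
          (nonNeg-+-pos (nonNeg-* (nonNeg-⌜⌝ 18) (nonNeg-* (nonNeg-square α) 0≤p))
          (nonNeg-+-pos (nonNeg-* (nonNeg-⌜⌝ 2) (nonNeg-* 0≤β (nonNeg-square _)))
          (nonNeg-+-pos (nonNeg-* (nonNeg-⌜⌝ 4) β≤norm) (pos-* (pos-norm x escaping) big))))))))
          where
          0≤p = nonNeg-* 0≤α (nonNeg-square u)
          0≤q = nonNeg-* 0≤β (nonNeg-square v)

        escaping-step : ∀ s t x → Escaping x →
          norm x < norm (Orbit.step (ι (± s) * α) (ι (± t) * β) x) × Escaping (Orbit.step (ι (± s) * α) (ι (± t) * β) x)
        escaping-step s t x escaping@(big , β≤norm) = grows ,
          pos-resp-≈ (solve 3 (λ n n′ c → (n :* n :- c) :+ (n′ :- n) :* ((n′ :- n) :+ (n :+ n)) := n′ :* n′ :- c) refl (norm x) (norm x′) threshold)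
            (pos-+ big (pos-* grows (pos-+ grows (pos-+ n>0 n>0)))) ,
          inj₁ (pos-resp-≈ (solve 3 (λ n n′ b → (n :- b) :+ (n′ :- n) := n′ :- b) refl (norm x) (norm x′) β)
            (nonNeg-+-pos β≤norm grows))
          where
          x′ = Orbit.step (ι (± s) * α) (ι (± t) * β) x
          grows = norm-grows s t x escaping
          n>0 = pos-norm x escaping

        module _ (s t : Sign) where

          open Orbit (ι (± s) * α) (ι (± t) * β)

          norm-cong : ∀ x y → P x ≈ P y → Q x ≈ Q y → norm x ≈ norm y
          norm-cong (u , v) (u′ , v′) P≈ Q≈ = +-cong (unsign s α (u * u) (u′ * u′) P≈) (unsign t β (v * v) (v′ * v′) Q≈)
            where
            undo : ∀ s α w → ι (± s) * (ι (± s) * α * w) ≈ α * w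
            undo Sign.+ = solve 2 (λ α w → con (± Sign.+) :* (con (± Sign.+) :* α :* w) := α :* w) refl
            undo Sign.- = solve 2 (λ α w → con (± Sign.-) :* (con (± Sign.-) :* α :* w) := α :* w) refl
            unsign : ∀ s α w w′ → ι (± s) * α * w ≈ ι (± s) * α * w′ → α * w ≈ α * w′
            unsign s α w w′ eq = trans (sym (undo s α w)) (trans (*-congˡ eq) (undo s α w′))

          module _ (recurrent : Recurrent) where

            ¬escaping : ∀ n → ¬ Escaping (orbit n)
            ¬escaping = growing⇒¬recurrent {_⊏_ = λ x y → norm x < norm y} <-trans (escaping-step s t)
              (λ x y P≈ Q≈ → <-irrefl (norm-cong x y P≈ Q≈)) recurrent

            private
              n₁² = ⌜ 4 ⌝ * (α * (α * α)) + β

              first-bounded : ¬ Positive (n₁² * n₁² - threshold)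
              first-bounded big = ¬escaping 1
                ( pos-resp-≈ (+-congʳ (sym (*-cong (norm-first s t) (norm-first s t)))) big
                , nonNeg-resp-≈ (trans (solve 2 (λ a b → a := a :+ b :- b) refl _ β) (+-congʳ (sym (norm-first s t))))
                    (nonNeg-* (nonNeg-⌜⌝ 4) (nonNeg-* 0≤α (nonNeg-square α))))

            -- For α ≥ 3/2 the quantity (4α³ + β)² - 6 - 36α² is expanded in y = α² - 9/4, with
            -- nonnegative coefficients and the value 381/4 at α = 3/2, β = 0. At α = 5/4, β = 0 it
            -- is still negative, so the round bound 3/2 loses nothing: once 4|A| is an integer, it
            -- is at most 5.
            α<3/2 : α < ι (+ 3 / 2)
            α<3/2 with <-or-≥ α (ι (+ 3 / 2))
            ... | inj₁ α<3/2 = α<3/2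
            ... | inj₂ 3/2≤α = ⊥-elim (first-bounded (pos-resp-≈
              (solve 2 (λ α β → let y = (α :- con (+ 3 / 2)) :* ((α :- con (+ 3 / 2)) :+ # 3); n = # 4 :* (α :* (α :* α)) :+ β in
                (# 16 :* (y :* (y :* y)) :+ (# 108 :* (y :* y) :+ # 207 :* y)) :+ (# 8 :* (α :* (α :* α)) :* β :+ β :* β) :+ con (+ 381 / 4)
                := n :* n :- (# 6 :+ # 36 :* (α :* α))) refl α β)
              (nonNeg-+-pos (nonNeg-+
                (nonNeg-+ (nonNeg-* (nonNeg-⌜⌝ 16) (nonNeg-* 0≤y (nonNeg-square _)))
                  (nonNeg-+ (nonNeg-* (nonNeg-⌜⌝ 108) (nonNeg-square _)) (nonNeg-* (nonNeg-⌜⌝ 207) 0≤y)))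
                (nonNeg-+ (nonNeg-* (nonNeg-* (nonNeg-⌜⌝ 8) (nonNeg-* 0≤α (nonNeg-square α))) 0≤β) (nonNeg-square β)))
                (pos-ι (+ 381 / 4) (ℚ.positive⁻¹ _)))))
              where
              0≤y = nonNeg-* 3/2≤α (nonNeg-+ 3/2≤α (nonNeg-⌜⌝ 3))

            -- Since α < 3/2, the threshold is below 6 + 36 · 9/4 = 87, and 75/8 = 150/16 is the
            -- least multiple of 1/16 whose square exceeds 87; the excess is 57/64.
            β<75/8 : β < ι (+ 75 / 8)
            β<75/8 with <-or-≥ β (ι (+ 75 / 8))
            ... | inj₁ β<75/8 = β<75/8
            ... | inj₂ 75/8≤β = ⊥-elim (first-bounded (pos-resp-≈
              (solve 2 (λ α β → let z = β :- con (+ 75 / 8); w = con (+ 3 / 2) :- α; n = # 4 :* (α :* (α :* α)) :+ β in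
                (z :* z :+ con (+ 75 / 4) :* z) :+ (# 36 :* (w :* (α :+ con (+ 3 / 2)))
                  :+ (# 16 :* ((α :* (α :* α)) :* (α :* (α :* α))) :+ # 8 :* (α :* (α :* α)) :* β)) :+ con (+ 57 / 64)
                := n :* n :- (# 6 :+ # 36 :* (α :* α))) refl α β)
              (nonNeg-+-pos (nonNeg-+
                (nonNeg-+ (nonNeg-square _) (nonNeg-* (inj₁ (pos-ι (+ 75 / 4) (ℚ.positive⁻¹ _))) 75/8≤β))
                (nonNeg-+ (nonNeg-* (nonNeg-⌜⌝ 36) (nonNeg-* (inj₁ α<3/2) (nonNeg-+ 0≤α (inj₁ (pos-ι (+ 3 / 2) (ℚ.positive⁻¹ _))))))
                  (nonNeg-+ (nonNeg-* (nonNeg-⌜⌝ 16) (nonNeg-square _))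
                    (nonNeg-* (nonNeg-* (nonNeg-⌜⌝ 8) (nonNeg-* 0≤α (nonNeg-square α))) 0≤β))))
                (pos-ι (+ 57 / 64) (ℚ.positive⁻¹ _)))))

  -- Completing the cube: h = -b/(3a) is the midpoint of the critical points and Δ is the square of
  -- half their difference. Division by a is expressed through an inverse `j`, so the identity holds
  -- in any commutative ℚ-algebra.
  depress : ∀ a b c d j → j * a ≈ 1# →
    let i = ι (+ 1 / 3) * j
        h = - (b * i)
        Δ = h * h - c * i
        E = h - a * (h * (h * h)) + ⌜ 3 ⌝ * (a * (Δ * h))
    in d ≈ (d - E) + E × c ≈ ⌜ 3 ⌝ * (a * (h * h - Δ)) × b ≈ - (⌜ 3 ⌝ * (a * h))
  depress a b c d j ja≈1 = solve 2 (λ d E → d := (d :- E) :+ E) refl d _ ,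
    trans (unit c) (solve 4 (λ a b c j → let i = con (+ 1 / 3) :* j; h = :- (b :* i) in
      j :* a :* c := # 3 :* (a :* (h :* h :- (h :* h :- c :* i)))) refl a b c j) ,
    trans (unit b) (solve 3 (λ a b j → j :* a :* b := :- (# 3 :* (a :* :- (b :* (con (+ 1 / 3) :* j))))) refl a b j)
    where
    unit : ∀ x → x ≈ j * a * x
    unit x = trans (sym (*-identityˡ x)) (*-congʳ (sym ja≈1))

  -- Coefficients of h + a (z - h)³ - 3aΔ (z - h) + D, whose critical points are h ± √Δ.
  coefficient₀ coefficient₁ coefficient₂ : Carrier → Carrier → Carrier → Carrier → Carrier
  coefficient₀ a h Δ D = D + (h - a * (h * (h * h)) + ⌜ 3 ⌝ * (a * (Δ * h)))
  coefficient₁ a h Δ D = ⌜ 3 ⌝ * (a * (h * h - Δ))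
  coefficient₂ a h Δ D = - (⌜ 3 ⌝ * (a * h))

-- Compatibility of normal forms and state orbits with ring homomorphisms.

module Transfer {c₁ ℓ₁ c₂ ℓ₂} (K₁ : CommutativeRing c₁ ℓ₁) (K₂ : CommutativeRing c₂ ℓ₂)
  (ι : ℚ → CommutativeRing.Carrier K₁) (ι-hom : IsRingHomomorphism +-*-rawRing (CommutativeRing.rawRing K₁) ι)
  (φ : CommutativeRing.Carrier K₁ → CommutativeRing.Carrier K₂)
  (φ-hom : IsRingHomomorphism (CommutativeRing.rawRing K₁) (CommutativeRing.rawRing K₂) φ)
  (φι-hom : IsRingHomomorphism +-*-rawRing (CommutativeRing.rawRing K₂) (φ ∘ ι)) where

  private
    module K₁ = CommutativeRing K₁
    module D₁ = CriticalDynamics K₁ ι ι-hom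
    module D₂ = CriticalDynamics K₂ (φ ∘ ι) φι-hom
  open CommutativeRing K₂
  open IsRingHomomorphism φ-hom using (+-homo; *-homo; -‿homo)

  private
    infixl 6 _⊕_ _⊖_
    infixl 7 _⊗_
    infix  8 ⊝_

    -- Named after the ring operations so that a proof below repeats the shape of the expression
    -- carried over, with `leaf` at the atoms.
    _⊕_ : ∀ {p q x y} → φ p ≈ x → φ q ≈ y → φ (p K₁.+ q) ≈ x + y
    p≈ ⊕ q≈ = trans (+-homo _ _) (+-cong p≈ q≈)

    _⊗_ : ∀ {p q x y} → φ p ≈ x → φ q ≈ y → φ (p K₁.* q) ≈ x * y
    p≈ ⊗ q≈ = trans (*-homo _ _) (*-cong p≈ q≈)

    ⊝_ : ∀ {p x} → φ p ≈ x → φ (K₁.- p) ≈ - x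
    ⊝ p≈ = trans (-‿homo _) (-‿cong p≈)

    _⊖_ : ∀ {p q x y} → φ p ≈ x → φ q ≈ y → φ (p K₁.- q) ≈ x - y
    p≈ ⊖ q≈ = p≈ ⊕ ⊝ q≈

    leaf : ∀ {p} → φ p ≈ φ p
    leaf = refl

  module _ (a h Δ D : K₁.Carrier) where

    φ-coefficient₀ : φ (D₁.coefficient₀ a h Δ D) ≈ D₂.coefficient₀ (φ a) (φ h) (φ Δ) (φ D)
    φ-coefficient₀ = leaf ⊕ (leaf ⊖ leaf ⊗ (leaf ⊗ (leaf ⊗ leaf)) ⊕ leaf ⊗ (leaf ⊗ (leaf ⊗ leaf)))

    φ-coefficient₁ : φ (D₁.coefficient₁ a h Δ D) ≈ D₂.coefficient₁ (φ a) (φ h) (φ Δ) (φ D)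
    φ-coefficient₁ = leaf ⊗ (leaf ⊗ (leaf ⊗ leaf ⊖ leaf))

    φ-coefficient₂ : φ (D₁.coefficient₂ a h Δ D) ≈ D₂.coefficient₂ (φ a) (φ h) (φ Δ) (φ D)
    φ-coefficient₂ = ⊝ (leaf ⊗ (leaf ⊗ leaf))

    φ-A : φ (a K₁.* Δ) ≈ φ a * φ Δ
    φ-A = leaf ⊗ leaf

    φ-e : φ (a K₁.* (D K₁.* D)) ≈ φ a * (φ D * φ D)
    φ-e = leaf ⊗ (leaf ⊗ leaf)

    private
      module O₁ = D₁.Orbit (a K₁.* Δ) (a K₁.* (D K₁.* D))
      module O₂ = D₂.Orbit (φ a * φ Δ) (φ a * (φ D * φ D))

    φ-orbit : ∀ n → φ (proj₁ (O₁.orbit n)) ≈ proj₁ (O₂.orbit n) × φ (proj₂ (O₁.orbit n)) ≈ proj₂ (O₂.orbit n)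
    φ-P : ∀ n → φ (O₁.P (O₁.orbit n)) ≈ O₂.P (O₂.orbit n)
    φ-Q : ∀ n → φ (O₁.Q (O₁.orbit n)) ≈ O₂.Q (O₂.orbit n)
    φ-orbit zero    = refl , refl
    φ-orbit (suc n) = proj₁ (φ-orbit n) ⊗ (φ-P n ⊕ leaf ⊗ φ-Q n ⊖ leaf ⊗ φ-A) , proj₂ (φ-orbit n) ⊗ (leaf ⊗ φ-P n ⊕ φ-Q n ⊖ leaf ⊗ φ-A) ⊕ leaf
    φ-P n = φ-A ⊗ (proj₁ (φ-orbit n) ⊗ proj₁ (φ-orbit n))
    φ-Q n = φ-e ⊗ (proj₂ (φ-orbit n) ⊗ proj₂ (φ-orbit n))

module Rational where

  open import Algebra.Properties.CommutativeSemigroup (CommutativeRing.*-commutativeSemigroup ℚ.+-*-commutativeRing) using (interchange)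
  open import Data.Rational.Base hiding (_≤_; NonNegative; Positive; _/_; ℚ; 0ℚ; 1ℚ; +-*-rawRing)
  open ≡ using (refl; sym; trans; cong; subst; subst₂; module ≡-Reasoning)

  *-cancelʳ : ∀ x y z → z ≢ 0ℚ → x * z ≡ y * z → x ≡ y
  *-cancelʳ x y z z≢0 xz≡yz = begin
    x              ≡⟨ undo x ⟨
    x * z * 1/ z   ≡⟨ cong (_* 1/ z) xz≡yz ⟩
    y * z * 1/ z   ≡⟨ undo y ⟩
    y              ∎
    where
    open ≡-Reasoning
    instance z-nonZero = ≢-nonZero z≢0
    undo : ∀ w → w * z * 1/ z ≡ w
    undo w = trans (ℚ.*-assoc w z (1/ z)) (trans (cong (w *_) (ℚ.*-inverseʳ z)) (ℚ.*-identityʳ w))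

  -- p-integrality and the p-adic comparison of rational numbers.

  module Divisibility (p : ℕ) (p-prime : Prime p) where

    Integral : ℚ → Set
    Integral x = ¬ (p ∣ ↧ₙ x)

    private
      p∤1 : ¬ (p ∣ 1)
      p∤1 p∣1 = ¬prime[1] (subst Prime (∣1⇒≡1 p∣1) p-prime)

      -- `k` is the factor cancelled when a sum or product over the denominator `↧ x ℤ.* ↧ y` is
      -- brought to lowest terms. A prime dividing the reduced denominator therefore divides one of
      -- the two old ones.
      divides-denominators : ∀ x y z k → ↧ z ℤ.* k ≡ ↧ x ℤ.* ↧ y → Integral x → Integral y → Integral z
      divides-denominators x y z k eq ix iy p∣z =
        [ ix , iy ]′ (euclidsLemma (↧ₙ x) (↧ₙ y) p-prime
          (subst (p ∣_) (trans (sym (ℤ.abs-* (↧ z) k)) (trans (cong ℤ.∣_∣ eq) (ℤ.abs-* (↧ x) (↧ y))))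
            (∣m⇒∣m*n ℤ.∣ k ∣ p∣z)))

    integral-+ : ∀ x y → Integral x → Integral y → Integral (x + y)
    integral-+ x y = divides-denominators x y (x + y) _ (ℚ.↧-+ x y)

    integral-* : ∀ x y → Integral x → Integral y → Integral (x * y)
    integral-* x y = divides-denominators x y (x * y) _ (ℚ.↧-* x y)

    integral-fromℤ : ∀ i → Integral (fromℤ i)
    integral-fromℤ i = p∤1

    integral-or-inverse : ∀ x → .{{_ : NonZero x}} → Integral x ⊎ Integral (1/ x)
    integral-or-inverse x with p ∣? ↧ₙ x
    ... | no  p∤x = inj₁ p∤x
    ... | yes p∣x = inj₂ (inverse-integral x p∣x)
      where
      inverse-integral : ∀ x → .{{_ : NonZero x}} → p ∣ ↧ₙ x → Integral (1/ x)
      -- The denominator of 1/x is the absolute value of the numerator of x; in lowest terms p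
      -- cannot divide it together with the denominator of x.
      inverse-integral (mkℚ (+ suc n) d c)  p∣d p∣n = ¬prime[1] (subst Prime (Coprimality.recompute c (p∣n , p∣d)) p-prime)
      inverse-integral (mkℚ -[1+ n ]  d c) p∣d p∣n = ¬prime[1] (subst Prime (Coprimality.recompute c (p∣n , p∣d)) p-prime)

    infix 4 _≼_ _≼?_

    -- x ≼ y says |x|ₚ ≤ |y|ₚ.
    _≼_ : ℚ → ℚ → Set
    x ≼ y = ∃[ t ] Integral t × x ≡ t * y

    ≼-refl : ∀ {x} → x ≼ x
    ≼-refl {x} = 1ℚ , integral-fromℤ (+ 1) , sym (ℚ.*-identityˡ x)

    ≼-trans : ∀ {x y z} → x ≼ y → y ≼ z → x ≼ z
    ≼-trans {z = z} (t , it , refl) (s , is , refl) = t * s , integral-* t s it is , sym (ℚ.*-assoc t s z)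

    0≼ : ∀ {x} → 0ℚ ≼ x
    0≼ {x} = 0ℚ , integral-fromℤ (+ 0) , sym (ℚ.*-zeroˡ x)

    private
      quotient-* : ∀ x y .{{_ : NonZero y}} → x ≡ x * 1/ y * y
      quotient-* x y = trans (sym (ℚ.*-identityʳ x))
        (trans (cong (x *_) (sym (ℚ.*-inverseˡ y))) (sym (ℚ.*-assoc x (1/ y) y)))

    ≼-total : ∀ x y → x ≼ y ⊎ y ≼ x
    ≼-total x y with y ℚ.≟ 0ℚ | x ℚ.≟ 0ℚ
    ... | yes refl | _        = inj₂ 0≼
    ... | no  _    | yes refl = inj₁ 0≼
    ... | no  y≢0  | no  x≢0  =
      [ (λ iq → inj₁ (q , iq , x≡qy))
      , (λ iq⁻¹ → inj₂ (1/ q , iq⁻¹ , y≡q⁻¹x)) ]′ (integral-or-inverse q)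
      where
      instance y-nonZero = ≢-nonZero y≢0
      q = x * 1/ y
      x≡qy = quotient-* x y
      instance
       q-nonZero : NonZero q
       q-nonZero = ≢-nonZero {q} λ q≡0 → x≢0 (trans x≡qy (trans (cong (_* y) q≡0) (ℚ.*-zeroˡ y)))
      y≡q⁻¹x : y ≡ 1/ q * x
      y≡q⁻¹x = trans (sym (ℚ.*-identityˡ y)) (trans (cong (_* y) (sym (ℚ.*-inverseˡ q)))
        (trans (ℚ.*-assoc (1/ q) q y) (cong (1/ q *_) (sym x≡qy))))

    _≼?_ : ∀ x y → Dec (x ≼ y)
    x ≼? y with y ℚ.≟ 0ℚ
    x ≼? y | yes refl with x ℚ.≟ 0ℚ
    ... | yes refl = yes 0≼
    ... | no  x≢0  = no λ (t , _ , x≡t0) → x≢0 (trans x≡t0 (ℚ.*-zeroʳ t))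
    x ≼? y | no y≢0 with p ∣? ↧ₙ q
      where q = (x ÷ y) {{≢-nonZero y≢0}}
    ... | no  iq  = yes (_÷_ x y {{≢-nonZero y≢0}} , iq , quotient-* x y {{≢-nonZero y≢0}})
    ... | yes p∣q = no λ (t , it , x≡ty) → it (subst (λ z → p ∣ ↧ₙ z)
            (*-cancelʳ (_÷_ x y {{≢-nonZero y≢0}}) t y y≢0 (trans (sym (quotient-* x y {{≢-nonZero y≢0}})) x≡ty)) p∣q)

    ≼-+ : ∀ {x y z} → x ≼ z → y ≼ z → x + y ≼ z
    ≼-+ {z = z} (t , it , refl) (s , is , refl) = t + s , integral-+ t s it is , sym (ℚ.*-distribʳ-+ z t s)

    ≼-* : ∀ {x y x′ y′} → x ≼ y → x′ ≼ y′ → x * x′ ≼ y * y′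
    ≼-* {y = y} {y′ = y′} (t , it , refl) (s , is , refl) = t * s , integral-* t s it is ,
      interchange t y s y′

    ≼-*-cancelʳ : ∀ {x y z} → z ≢ 0ℚ → x * z ≼ y * z → x ≼ y
    ≼-*-cancelʳ {x} {y} {z} z≢0 (t , it , eq) =
      t , it , *-cancelʳ x (t * y) z z≢0 (trans eq (sym (ℚ.*-assoc t y z)))

    ≼1⇒integral : ∀ {x} → x ≼ 1ℚ → Integral x
    ≼1⇒integral (t , it , refl) = subst Integral (sym (ℚ.*-identityʳ t)) it

  -- A prime factor of the denominator would contradict integrality at that prime; an empty
  -- factorisation means that the denominator is 1.
  integral⇒integer : ∀ x → (∀ p (p-prime : Prime p) → Divisibility.Integral p p-prime x) → x ≡ fromℤ (↥ x)
  integral⇒integer x@(mkℚ n d c) integral with factorise (suc d)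
  ... | record { factors = [] ; isFactorisation = refl } = refl
  ... | record { factors = q ∷ qs ; isFactorisation = eq ; factorsPrime = q-prime ∷ _ } =
    contradiction (subst (q ∣_) (sym eq) (m∣m*n _)) (integral q q-prime)

  open CriticalDynamics ℚ.+-*-commutativeRing id (Identity.isRingHomomorphism +-*-rawRing refl)
    using (ValuationPreorder; PositiveCone; module NonArchimedean; module Ordered)
    renaming ( module Orbit to ℚ-Orbit; depress to ℚ-depress; coefficient₀ to ℚ-coefficient₀
             ; coefficient₁ to ℚ-coefficient₁; coefficient₂ to ℚ-coefficient₂) public

  -- The p-adic and the usual order on ℚ as instances of the two growth arguments.

  divisibilityPreorder : ∀ p → Prime p → ValuationPreorder 0ℓ
  divisibilityPreorder p p-prime = record
    { _≼_         = _≼_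
    ; ≼-reflexive = λ { refl → ≼-refl }
    ; ≼-trans     = ≼-trans
    ; ≼-total     = ≼-total
    ; _≼?_        = _≼?_
    ; ≼-+         = ≼-+
    ; ≼-*         = ≼-*
    ; ≼-*-cancelʳ = ≼-*-cancelʳ
    ; integers≼1  = λ i → fromℤ i , integral-fromℤ i , sym (ℚ.*-identityʳ (fromℤ i))
    }
    where open Divisibility p p-prime

  ℚ-positiveCone : PositiveCone 0ℓ
  ℚ-positiveCone = record
    { Positive   = 0ℚ <_
    ; pos-resp-≈ = λ { refl → id }
    ; pos-+      = ℚ.+-mono-<
    ; pos-*      = λ {x} {y} 0<x 0<y → ℚ.positive⁻¹ (x * y) {{ℚ.pos*pos⇒pos x {{positive 0<x}} y {{positive 0<y}}}}
    ; trichotomy = trichotomy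
    ; 0-not-pos  = ℚ.<-irrefl refl
    ; pos-ι      = λ _ → id
    }
    where
    trichotomy : ∀ x → 0ℚ < x ⊎ x ≡ 0ℚ ⊎ 0ℚ < - x
    trichotomy x with ℚ.<-cmp 0ℚ x
    ... | tri< 0<x _ _ = inj₁ 0<x
    ... | tri≈ _ 0≡x _ = inj₂ (inj₁ (sym 0≡x))
    ... | tri> _ _ x<0 = inj₂ (inj₂ (ℚ.neg-antimono-< x<0))

  open Ordered ℚ-positiveCone using (NonNegative; Escaping; ¬escaping; α<3/2; β<75/8)

  -- The fifteen normal forms and the finite search.

  record NormalForm : Set where
    constructor normalForm
    field a h Δ D : ℚ

    A e : ℚ
    A = a * Δ
    e = a * (D * D)

  -- The critical points are 0 twice for the first two, 0 and 1 for the next eleven (hence h = 1/2,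
  -- Δ = 1/4), and the square roots of 2 and of -7 for the last two.
  normalForms : Vec NormalForm 15
  normalForms =
    normalForm (+ 1 / 1) (+ 0 / 1) (+ 0 / 1) (+ 0 / 1) ∷
    normalForm (-[1+ 0 ] / 1) (+ 0 / 1) (+ 0 / 1) (+ 1 / 1) ∷
    normalForm (-[1+ 1 ] / 1) (+ 1 / 2) (+ 1 / 4) (+ 1 / 2) ∷
    normalForm (-[1+ 1 ] / 1) (+ 1 / 2) (+ 1 / 4) (+ 0 / 1) ∷
    normalForm (-[1+ 0 ] / 1) (+ 1 / 2) (+ 1 / 4) (+ 3 / 4) ∷
    normalForm (+ 2 / 1) (+ 1 / 2) (+ 1 / 4) (+ 0 / 1) ∷
    normalForm (+ 2 / 1) (+ 1 / 2) (+ 1 / 4) (-[1+ 0 ] / 2) ∷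
    normalForm (+ 1 / 1) (+ 1 / 2) (+ 1 / 4) (-[1+ 2 ] / 4) ∷
    normalForm (-[1+ 2 ] / 1) (+ 1 / 2) (+ 1 / 4) (+ 1 / 4) ∷
    normalForm (-[1+ 3 ] / 1) (+ 1 / 2) (+ 1 / 4) (+ 0 / 1) ∷
    normalForm (+ 4 / 1) (+ 1 / 2) (+ 1 / 4) (+ 0 / 1) ∷
    normalForm (+ 3 / 1) (+ 1 / 2) (+ 1 / 4) (-[1+ 0 ] / 4) ∷
    normalForm (-[1+ 0 ] / 1) (+ 1 / 2) (+ 1 / 4) (-[1+ 4 ] / 4) ∷
    normalForm (-[1+ 0 ] / 4) (+ 0 / 1) (+ 2 / 1) (+ 2 / 1) ∷
    normalForm (-[1+ 0 ] / 28) (+ 0 / 1) (-[1+ 6 ] / 1) (+ 7 / 2) ∷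
    []

  Listed : ℚ → ℚ → Set
  Listed A e = ∃[ i ] NormalForm.A (lookup normalForms i) ≡ A × NormalForm.e (lookup normalForms i) ≡ e

  module _ (A e α β : ℚ) where

    open ℚ-Orbit A e

    -- The divisibilities contradict orbit-integral at the prime 2.
    Escapes : ℕ → State → Set
    Escapes zero    x = ⊥
    Escapes (suc n) x = Escaping α β x ⊎ 2 ∣ ↧ₙ (fromℕ 4 * R x) ⊎ 2 ∣ ↧ₙ (fromℕ 4 * N x) ⊎ Escapes n (step x)

    escaping? : ∀ x → Dec (Escaping α β x)
    escaping? x = (0ℚ ℚ.<? _) ×-dec ((0ℚ ℚ.<? _) ⊎-dec (_ ℚ.≟ 0ℚ))

    escapes? : ∀ n x → Dec (Escapes n x)
    escapes? zero    x = no id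
    escapes? (suc n) x = escaping? x ⊎-dec (2 ∣? _) ⊎-dec (2 ∣? _) ⊎-dec escapes? n (step x)

  module Candidate (s t : Sign) (k m : ℕ) where

    α β A e : ℚ
    α = + 1 / 4 * fromℕ k
    β = + 1 / 16 * fromℕ m
    A = ± s * α
    e = ± t * β

    Resolved : Set
    -- Four states are inspected: the critical state `(1 , 0)` and its first three images.
    Resolved = Escapes A e α β 4 (ℚ-Orbit.orbit A e 0) ⊎ Listed A e

    resolved? : Dec Resolved
    resolved? = escapes? A e α β 4 (ℚ-Orbit.orbit A e 0) ⊎-dec
      any? λ i → (NormalForm.A (lookup normalForms i) ℚ.≟ A) ×-dec (NormalForm.e (lookup normalForms i) ℚ.≟ e)

  open Candidate using (Resolved; resolved?)

  2-prime : Prime 2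
  2-prime = toWitness {a? = prime? 2} _

  -- Settled by evaluating the decision procedure on 6 · 150 pairs for each choice of signs; the
  -- ranges are 4|A| < 4 · 3/2 and 16|e| < 16 · 75/8.
  all-resolved : ∀ s t {k} → k ℕ.< 6 → ∀ {m} → m ℕ.< 150 → Resolved s t k m
  all-resolved Sign.+ Sign.+ = toWitness {a? = ℕ.allUpTo? (λ k → ℕ.allUpTo? (resolved? Sign.+ Sign.+ k) 150) 6} _
  all-resolved Sign.+ Sign.- = toWitness {a? = ℕ.allUpTo? (λ k → ℕ.allUpTo? (resolved? Sign.+ Sign.- k) 150) 6} _
  all-resolved Sign.- Sign.+ = toWitness {a? = ℕ.allUpTo? (λ k → ℕ.allUpTo? (resolved? Sign.- Sign.+ k) 150) 6} _
  all-resolved Sign.- Sign.- = toWitness {a? = ℕ.allUpTo? (λ k → ℕ.allUpTo? (resolved? Sign.- Sign.- k) 150) 6} _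

  -- From recurrence to a listed pair of invariants.

  ∣_∣-signed : ∀ x → ∃[ s ] x ≡ ± s * ∣ x ∣
  ∣ x ∣-signed with ℚ.∣p∣≡p∨∣p∣≡-p x
  ... | inj₁ ∣x∣≡x  = Sign.+ , sym (trans (ℚ.*-identityˡ ∣ x ∣) ∣x∣≡x)
  ... | inj₂ ∣x∣≡-x = Sign.- , sym (trans (sym (ℚ.neg-distribˡ-* 1ℚ ∣ x ∣)) (trans (cong -_ (trans (ℚ.*-identityˡ ∣ x ∣) ∣x∣≡-x)) (neg-involutive x)))
    where open import Algebra.Properties.Ring ℚ.+-*-ring using () renaming (-‿involutive to neg-involutive)

  bounded-multiple : ∀ d x {i} B .{{_ : NonZero (fromℕ d)}} .{{_ : ℚ.Positive (fromℕ d)}} → fromℕ d * x ≡ fromℤ i → ∣ x ∣ < B →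
    ∃[ k ] ∣ x ∣ ≡ 1/ (fromℕ d) * fromℕ k × fromℕ k < fromℕ d * B
  bounded-multiple d x {i} B dx≡i ∣x∣<B = ℤ.∣ i ∣ , ∣x∣≡ , subst (_< fromℕ d * B) d∣x∣≡ (ℚ.*-monoʳ-<-pos (fromℕ d) ∣x∣<B)
    where
    d∣x∣≡ : fromℕ d * ∣ x ∣ ≡ fromℕ ℤ.∣ i ∣
    d∣x∣≡ = trans (sym (ℚ.∣p*q∣≡∣p∣*∣q∣ (fromℕ d) x)) (cong ∣_∣ dx≡i)
    ∣x∣≡ : ∣ x ∣ ≡ 1/ (fromℕ d) * fromℕ ℤ.∣ i ∣
    ∣x∣≡ = trans (sym (ℚ.*-identityˡ ∣ x ∣)) (trans (cong (_* ∣ x ∣) (sym (ℚ.*-inverseˡ (fromℕ d))))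
      (trans (ℚ.*-assoc (1/ (fromℕ d)) (fromℕ d) ∣ x ∣) (cong (1/ (fromℕ d) *_) d∣x∣≡)))

  fromℕ-cancel-< : ∀ {m n} → fromℕ m < fromℕ n → m ℕ.< n
  fromℕ-cancel-< m<n = ℤ.drop‿+<+ (subst₂ ℤ._<_ (ℤ.*-identityʳ _) (ℤ.*-identityʳ _) (ℚ.drop-*<* m<n))

  x-y>0⇒y<x : ∀ {x y} → 0ℚ < x - y → y < x
  x-y>0⇒y<x {x} {y} 0<x-y = subst₂ _<_ (ℚ.+-identityˡ y)
    (trans (ℚ.+-assoc x (- y) y) (trans (cong (λ z → x + z) (ℚ.+-inverseˡ y)) (ℚ.+-identityʳ x))) (ℚ.+-monoˡ-< y 0<x-y)

  nonNeg-∣∣ : ∀ x → NonNegative ∣ x ∣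
  nonNeg-∣∣ x with ℚ.<-cmp 0ℚ ∣ x ∣
  ... | tri< 0<∣x∣ _ _ = inj₁ 0<∣x∣
  ... | tri≈ _ 0≡∣x∣ _ = inj₂ (sym 0≡∣x∣)
  ... | tri> _ _ ∣x∣<0 = ⊥-elim (ℚ.<-irrefl refl (ℚ.<-≤-trans ∣x∣<0 (ℚ.0≤∣p∣ x)))

  module _ (s t : Sign) (k m : ℕ) where

    open Candidate s t k m using (α; β; A; e)
    open ℚ-Orbit A e
    open Divisibility 2 2-prime using (≼1⇒integral)

    recurrent⇒¬escapes : NonNegative α → NonNegative β → Recurrent → ∀ n i → ¬ Escapes A e α β n (orbit i)
    recurrent⇒¬escapes 0≤α 0≤β recurrent (suc n) i =
      [ ¬escaping α β 0≤α 0≤β s t recurrent i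
      , [ ≼1⇒integral (proj₁ integral) , [ ≼1⇒integral (proj₂ integral) , recurrent⇒¬escapes 0≤α 0≤β recurrent n (suc i) ]′ ]′ ]′
      where integral = NonArchimedean.orbit-integral (divisibilityPreorder 2 2-prime) A e recurrent i

  module _ (A e : ℚ) (recurrent : ℚ-Orbit.Recurrent A e) where

    private
      4·A-integer : fromℕ 4 * A ≡ fromℤ (↥ (fromℕ 4 * A))
      4·A-integer = integral⇒integer (fromℕ 4 * A) λ p p-prime → Divisibility.≼1⇒integral p p-prime
        (proj₁ (NonArchimedean.parameters-integral (divisibilityPreorder p p-prime) A e recurrent))

      16·e-integer : fromℕ 16 * e ≡ fromℤ (↥ (fromℕ 16 * e))
      16·e-integer = integral⇒integer (fromℕ 16 * e) λ p p-prime → Divisibility.≼1⇒integral p p-prime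
        (proj₂ (NonArchimedean.parameters-integral (divisibilityPreorder p p-prime) A e recurrent))

      candidate : ∀ s t → A ≡ ± s * ∣ A ∣ → e ≡ ± t * ∣ e ∣ →
        ∃[ k ] ∃[ m ] ∣ A ∣ ≡ + 1 / 4 * fromℕ k × ∣ e ∣ ≡ + 1 / 16 * fromℕ m × k ℕ.< 6 × m ℕ.< 150
      candidate s t A≡ e≡ = proj₁ k-bounded , proj₁ m-bounded , proj₁ (proj₂ k-bounded) , proj₁ (proj₂ m-bounded) ,
        fromℕ-cancel-< (proj₂ (proj₂ k-bounded)) , fromℕ-cancel-< (proj₂ (proj₂ m-bounded))
        where
        -- The real bounds speak of parameters written as a sign times a nonnegative number.
        recurrent± = subst₂ ℚ-Orbit.Recurrent A≡ e≡ recurrent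
        k-bounded = bounded-multiple 4 A (+ 3 / 2) 4·A-integer
          (x-y>0⇒y<x (α<3/2 ∣ A ∣ ∣ e ∣ (nonNeg-∣∣ A) (nonNeg-∣∣ e) s t recurrent±))
        m-bounded = bounded-multiple 16 e (+ 75 / 8) 16·e-integer
          (x-y>0⇒y<x (β<75/8 ∣ A ∣ ∣ e ∣ (nonNeg-∣∣ A) (nonNeg-∣∣ e) s t recurrent±))

      listed : ∀ s t k m → A ≡ ± s * ∣ A ∣ → e ≡ ± t * ∣ e ∣ → ∣ A ∣ ≡ + 1 / 4 * fromℕ k → ∣ e ∣ ≡ + 1 / 16 * fromℕ m →
        Resolved s t k m → Listed A e
      listed s t k m A≡ e≡ ∣A∣≡ ∣e∣≡ = [ (λ escapes → contradiction escapes ¬escapes) , subst₂ Listed (sym A≡′) (sym e≡′) ]′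
        where
        A≡′ : A ≡ Candidate.A s t k m
        A≡′ = trans A≡ (cong (± s *_) ∣A∣≡)
        e≡′ : e ≡ Candidate.e s t k m
        e≡′ = trans e≡ (cong (± t *_) ∣e∣≡)
        ¬escapes = recurrent⇒¬escapes s t k m (subst NonNegative ∣A∣≡ (nonNeg-∣∣ A)) (subst NonNegative ∣e∣≡ (nonNeg-∣∣ e))
          (subst₂ ℚ-Orbit.Recurrent A≡′ e≡′ recurrent) 4 0

    recurrent⇒listed : Listed A e
    recurrent⇒listed = conclude ∣ A ∣-signed ∣ e ∣-signed
      where
      conclude : (∃[ s ] A ≡ ± s * ∣ A ∣) → (∃[ t ] e ≡ ± t * ∣ e ∣) → Listed A e
      conclude (s , A≡) (t , e≡) = resolve (candidate s t A≡ e≡)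
        where
        resolve : (∃[ k ] ∃[ m ] ∣ A ∣ ≡ + 1 / 4 * fromℕ k × ∣ e ∣ ≡ + 1 / 16 * fromℕ m × k ℕ.< 6 × m ℕ.< 150) → Listed A e
        resolve (k , m , ∣A∣≡ , ∣e∣≡ , k<6 , m<150) = listed s t k m A≡ e≡ ∣A∣≡ ∣e∣≡ (all-resolved s t k<6 m<150)

  -- Rational cubics in normal form.

  module _ (nf : NormalForm) where

    open NormalForm nf
    open ℚ-Orbit A e

    c₀ c₁ c₂ : ℚ
    c₀ = ℚ-coefficient₀ a h Δ D
    c₁ = ℚ-coefficient₁ a h Δ D
    c₂ = ℚ-coefficient₂ a h Δ D

    toPoly : ℚ[z].Poly
    toPoly = cubic a c₂ c₁ c₀

    -- For Δ = 0 (for D = 0) the first (the second) coordinate of the state is irrelevant.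
    Preperiodic : ℕ → ℕ → Set
    Preperiodic i j = (Δ ≡ 0ℚ ⊎ proj₁ (orbit i) ≡ proj₁ (orbit j)) × (D ≡ 0ℚ ⊎ proj₂ (orbit i) ≡ proj₂ (orbit j))

    preperiodic? : ∀ i j → Dec (Preperiodic i j)
    preperiodic? i j = ((Δ ℚ.≟ 0ℚ) ⊎-dec (proj₁ (orbit i) ℚ.≟ proj₁ (orbit j))) ×-dec
                       ((D ℚ.≟ 0ℚ) ⊎-dec (proj₂ (orbit i) ℚ.≟ proj₂ (orbit j)))

  -- Stated through coefficients, since a list of coefficients may carry trailing zeros.
  record _HasNormalFormℚ_ (f : ℚ[z].Poly) (nf : NormalForm) : Set where
    field
      a≢0         : NormalForm.a nf ≢ 0ℚ
      coeff₀      : ℚ[z].coeff f 0 ≡ c₀ nf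
      coeff₁      : ℚ[z].coeff f 1 ≡ c₁ nf
      coeff₂      : ℚ[z].coeff f 2 ≡ c₂ nf
      coeff₃      : ℚ[z].coeff f 3 ≡ NormalForm.a nf
      coeff-above : ∀ n → ℚ[z].coeff f (4 ℕ.+ n) ≡ 0ℚ

  -- Evaluating the coefficient formulas at the table of normal forms gives back the fifteen
  -- polynomials of the theorem, entry by entry.
  representatives≡ : representatives ≡ Vec.map toPoly normalForms
  representatives≡ = refl

  leading≢0 : ∀ i → NormalForm.a (lookup normalForms i) ≢ 0ℚ
  leading≢0 = toWitness {a? = all? λ i → ¬? (NormalForm.a (lookup normalForms i) ℚ.≟ 0ℚ)} _

  -- All preperiods are at most 2 and all periods divide 6.
  preperiodic : ∀ i → Preperiodic (lookup normalForms i) 2 8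
  preperiodic = toWitness {a? = all? λ i → preperiodic? (lookup normalForms i) 2 8} _

  invariants-distinct : ∀ i j → NormalForm.A (lookup normalForms i) ≡ NormalForm.A (lookup normalForms j) →
    NormalForm.e (lookup normalForms i) ≡ NormalForm.e (lookup normalForms j) → i ≡ j
  invariants-distinct i j A≡ e≡ = conclude (toWitness {a? = all? λ i → all? (distinct? i)} _ i j)
    where
    A e : Fin 15 → ℚ
    A i = NormalForm.A (lookup normalForms i)
    e i = NormalForm.e (lookup normalForms i)
    distinct? : ∀ i j → Dec (¬ A i ≡ A j ⊎ ¬ e i ≡ e j ⊎ i ≡ j)
    distinct? i j = ¬? (A i ℚ.≟ A j) ⊎-dec ¬? (e i ℚ.≟ e j) ⊎-dec (i Fin.≟ j)
    conclude : ¬ A i ≡ A j ⊎ ¬ e i ≡ e j ⊎ i ≡ j → i ≡ j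
    conclude (inj₁ A≢)        = contradiction A≡ A≢
    conclude (inj₂ (inj₁ e≢)) = contradiction e≡ e≢
    conclude (inj₂ (inj₂ i≡j)) = i≡j

  representative-normalForm : ∀ i → lookup representatives i HasNormalFormℚ lookup normalForms i
  representative-normalForm i = subst (_HasNormalFormℚ lookup normalForms i)
    (sym (trans (cong (λ v → lookup v i) representatives≡) (lookup-map i toPoly normalForms)))
    (record { a≢0 = leading≢0 i ; coeff₀ = refl ; coeff₁ = refl ; coeff₂ = refl ; coeff₃ = refl ; coeff-above = λ _ → refl })

  normalise : ∀ f → ℚ[z].HasDegree f 3 → ∃[ nf ] f HasNormalFormℚ nf
  normalise f (a≢0 , above) = normalForm a h Δ D , record
    { a≢0         = a≢0
    ; coeff₀      = proj₁ coefficients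
    ; coeff₁      = proj₁ (proj₂ coefficients)
    ; coeff₂      = proj₂ (proj₂ coefficients)
    ; coeff₃      = refl
    ; coeff-above = λ n → above (4 ℕ.+ n) (ℕ.s≤s (ℕ.s≤s (ℕ.s≤s (ℕ.s≤s ℕ.z≤n))))
    }
    where
    a = ℚ[z].coeff f 3
    b = ℚ[z].coeff f 2
    c = ℚ[z].coeff f 1
    d = ℚ[z].coeff f 0
    instance a-nonZero = ≢-nonZero a≢0
    i = + 1 / 3 * 1/ a
    h = - (b * i)
    Δ = h * h - c * i
    D = d - (h - a * (h * (h * h)) + fromℕ 3 * (a * (Δ * h)))
    coefficients = ℚ-depress a b c d (1/ a) (ℚ.*-inverseˡ a)

open Rational

-- The algebraic closure as a field of characteristic zero.

module OverClosure {c ℓ₁ ℓ₂} (ℚ̄ : AlgebraicClosureOfℚ c ℓ₁ ℓ₂) where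

  open AlgebraicClosureOfℚ ℚ̄
  open IsRingHomomorphism ι-isHomomorphism using (+-homo; *-homo; -‿homo; 0#-homo; 1#-homo)

  K : CommutativeRing c ℓ₁
  K = HeytingCommutativeRing.commutativeRing heytingCommutativeRing

  open CommutativeRing K using (ring; +-rawMonoid)
  open import Algebra.Definitions.RawMonoid +-rawMonoid using () renaming (_×_ to _×ₙ_)
  open import Algebra.Properties.Ring ring using (-0#≈0#)
  open import Relation.Binary.Reasoning.Setoid setoid

  open ℚ-AlgebraSolver K ι ι-isHomomorphism
  open CriticalDynamics K ι ι-isHomomorphism using (⌜_⌝; module Orbit; coefficient₀; coefficient₁; coefficient₂)

  #⇒≉ : ∀ {x y} → x # y → ¬ x ≈ y
  #⇒≉ {x} {y} x#y x≈y = proj₂ (tight x y) x≈y x#y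

  inverse-* : ∀ {x} (x#0 : x # 0#) → inverse x#0 * x ≈ 1#
  inverse-* {x} x#0 = trans (*-congˡ (sym (trans (+-congˡ -0#≈0#) (+-identityʳ x)))) (proj₁ (proj₂ (#⇒invertible x#0)))

  1#0 : 1# # 0#
  1#0 = invertible⇒# (1# , trans (*-identityˡ _) 1-0≈1 , trans (*-identityʳ _) 1-0≈1)
    where 1-0≈1 = trans (+-congˡ -0#≈0#) (+-identityʳ 1#)

  invertible⇒#0 : ∀ {x y} → y * x ≈ 1# → x # 0#
  invertible⇒#0 {x} {y} yx≈1 = invertible⇒# (y , yx′≈1 , trans (*-comm _ y) yx′≈1)
    where yx′≈1 = trans (*-congˡ (trans (+-congˡ -0#≈0#) (+-identityʳ x))) yx≈1

  *-cancelˡ-# : ∀ {x y z} → x # 0# → x * y ≈ x * z → y ≈ z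
  *-cancelˡ-# {x} {y} {z} x#0 xy≈xz = trans (sym (undo y)) (trans (*-congˡ xy≈xz) (undo z))
    where
    undo : ∀ w → inverse x#0 * (x * w) ≈ w
    undo w = trans (sym (*-assoc _ x w)) (trans (*-congʳ (inverse-* x#0)) (*-identityˡ w))

  ¬#0⇒≈0 : ∀ {x} → ¬ (x # 0#) → x ≈ 0#
  ¬#0⇒≈0 {x} = proj₁ (tight x 0#)

  square≈0 : ∀ {x} → x * x ≈ 0# → x ≈ 0#
  square≈0 {x} xx≈0 with x #? 0#
  ... | yes x#0 = *-cancelˡ-# x#0 (trans xx≈0 (sym (zeroʳ x)))
  ... | no ¬x#0 = ¬#0⇒≈0 ¬x#0

  3*#0 : ∀ {x} → x # 0# → ⌜ 3 ⌝ * x # 0#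
  3*#0 {x} x#0 = invertible⇒#0 (trans
    (solve 2 (λ x i → con (+ 1 ℚ./ 3) :* i :* (# 3 :* x) := i :* x) refl x (inverse x#0)) (inverse-* x#0))

  ι-#0 : ∀ {q} → q ≢ 0ℚ → ι q # 0#
  ι-#0 {q} q≢0 = invertible⇒#0 (trans (sym (*-homo (ℚ.1/ q) q)) (trans (reflexive (≡.cong ι (ℚ.*-inverseˡ q))) 1#-homo))
    where instance q-nonZero = ℚ.≢-nonZero q≢0

  ι-injective : ∀ {p q} → ι p ≈ ι q → p ≡ q
  ι-injective {p} {q} ιp≈ιq with p ℚ.≟ q
  ... | yes p≡q = p≡q
  ... | no  p≢q = contradiction ι[p-q]≈0 (#⇒≉ (ι-#0 (p≢q ∘ ℚ-x-y≡0⇒x≡y p q)))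
    where
    open import Algebra.Properties.Group ℚ.+-0-group using () renaming (x∙y⁻¹≈ε⇒x≈y to ℚ-x-y≡0⇒x≡y)
    ι[p-q]≈0 = trans (+-homo p (ℚ.- q)) (trans (+-cong ιp≈ιq (-‿homo q)) (-‿inverseʳ (ι q)))

  open import Data.List.Membership.Setoid setoid using (_∈_)
  open import Algebra.Properties.Group (CommutativeRing.+-group K) using () renaming (x∙y⁻¹≈ε⇒x≈y to x-y≈0⇒x≈y)

  -- Coefficients of derivatives and of compositions with affine maps.

  Vanishes : Poly → Set ℓ₁
  Vanishes p = ∀ n → coeff p n ≈ 0#

  eval-vanishes : ∀ p → Vanishes p → ∀ x → eval p x ≈ 0#
  eval-vanishes []      _   x = refl
  eval-vanishes (a ∷ p) p≈0 x =
    trans (+-cong (p≈0 0) (trans (*-congˡ (eval-vanishes p (p≈0 ∘ suc) x)) (zeroʳ x))) (+-identityˡ 0#)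

  eval-cong : ∀ p {x y} → x ≈ y → eval p x ≈ eval p y
  eval-cong []      x≈y = refl
  eval-cong (a ∷ p) x≈y = +-congˡ (*-cong x≈y (eval-cong p x≈y))

  coeff-embed : ∀ p n → coeff (embed p) n ≈ ι (ℚ[z].coeff p n)
  coeff-embed []      n       = sym 0#-homo
  coeff-embed (a ∷ p) zero    = refl
  coeff-embed (a ∷ p) (suc n) = coeff-embed p n

  coeff-+ᴾ : ∀ p q n → coeff (p +ᴾ q) n ≈ coeff p n + coeff q n
  coeff-+ᴾ []      q       n       = sym (+-identityˡ _)
  coeff-+ᴾ (a ∷ p) []      n       = sym (+-identityʳ _)
  coeff-+ᴾ (a ∷ p) (b ∷ q) zero    = refl
  coeff-+ᴾ (a ∷ p) (b ∷ q) (suc n) = coeff-+ᴾ p q n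

  coeff-map-* : ∀ a p n → coeff (map (a *_) p) n ≈ a * coeff p n
  coeff-map-* a []      n       = sym (zeroʳ a)
  coeff-map-* a (b ∷ p) zero    = refl
  coeff-map-* a (b ∷ p) (suc n) = coeff-map-* a p n

  -- For an affine map αz + β, composition unfolds to β + g · (α + g · 0). The inner factor is a
  -- constant only up to trailing zeros, hence the hypotheses on the coefficients of `q`.
  coeff-*ᴾ-constant : ∀ p q {a} → coeff q 0 ≈ a → (∀ n → coeff q (suc n) ≈ 0#) → ∀ n → coeff (p *ᴾ q) n ≈ coeff p n * a
  coeff-*ᴾ-constant []      q q₀≈a q₊≈0 n = sym (zeroˡ _)
  coeff-*ᴾ-constant (b ∷ p) q {a} q₀≈a q₊≈0 zero = begin
    coeff (map (b *_) q +ᴾ (0# ∷ p *ᴾ q)) 0 ≈⟨ coeff-+ᴾ (map (b *_) q) _ 0 ⟩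
    coeff (map (b *_) q) 0 + 0#             ≈⟨ +-identityʳ _ ⟩
    coeff (map (b *_) q) 0                  ≈⟨ coeff-map-* b q 0 ⟩
    b * coeff q 0                           ≈⟨ *-congˡ q₀≈a ⟩
    b * a                                   ∎
  coeff-*ᴾ-constant (b ∷ p) q {a} q₀≈a q₊≈0 (suc n) = begin
    coeff (map (b *_) q +ᴾ (0# ∷ p *ᴾ q)) (suc n)    ≈⟨ coeff-+ᴾ (map (b *_) q) _ (suc n) ⟩
    coeff (map (b *_) q) (suc n) + coeff (p *ᴾ q) n  ≈⟨ +-cong (trans (coeff-map-* b q (suc n)) (trans (*-congˡ (q₊≈0 n)) (zeroʳ b)))
                                                                (coeff-*ᴾ-constant p q q₀≈a q₊≈0 n) ⟩
    0# + coeff p n * a                               ≈⟨ +-identityˡ _ ⟩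
    coeff p n * a                                    ∎

  module _ (t s : Carrier) where

    private
      ψ : Poly
      ψ = affine t s

      coeff-tψ : ∀ r n → coeff (map (t *_) r +ᴾ (0# ∷ [])) n ≈ t * coeff r n
      coeff-tψ r n = trans (coeff-+ᴾ (map (t *_) r) _ n)
        (trans (+-cong (coeff-map-* t r n) (0-coeff n)) (+-identityʳ _))
        where
        0-coeff : ∀ n → coeff (0# ∷ []) n ≈ 0#
        0-coeff zero    = refl
        0-coeff (suc n) = refl

    horner-zero : ∀ a r → coeff ((a ∷ []) +ᴾ ψ *ᴾ r) 0 ≈ a + s * coeff r 0
    horner-zero a r = trans (coeff-+ᴾ (a ∷ []) (ψ *ᴾ r) 0) (+-congˡ (trans (coeff-+ᴾ (map (s *_) r) _ 0)
      (trans (+-identityʳ _) (coeff-map-* s r 0))))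

    horner-suc : ∀ a r n → coeff ((a ∷ []) +ᴾ ψ *ᴾ r) (suc n) ≈ s * coeff r (suc n) + t * coeff r n
    horner-suc a r n = trans (coeff-+ᴾ (a ∷ []) (ψ *ᴾ r) (suc n)) (trans (+-identityˡ _)
      (trans (coeff-+ᴾ (map (s *_) r) _ (suc n)) (+-cong (coeff-map-* s r (suc n)) (coeff-tψ r n))))

    -- One Horner step multiplies by a linear polynomial and so raises the degree bound by one; four
    -- of them starting from 0 bound the degree of a cubic composed with ψ.
    horner-degree : ∀ a r k → (∀ n → coeff r (k ℕ.+ n) ≈ 0#) → ∀ n → coeff ((a ∷ []) +ᴾ ψ *ᴾ r) (suc k ℕ.+ n) ≈ 0#
    horner-degree a r k r≈0 n = trans (horner-suc a r (k ℕ.+ n)) (trans (+-cong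
      (trans (*-congˡ (trans (reflexive (≡.cong (coeff r) (≡.sym (ℕ.+-suc k n)))) (r≈0 (suc n)))) (zeroʳ s))
      (trans (*-congˡ (r≈0 n)) (zeroʳ t))) (+-identityˡ 0#))

    ∘ᴾ-vanishes : ∀ p → Vanishes p → Vanishes (p ∘ᴾ ψ)
    ∘ᴾ-vanishes []      _   n       = refl
    ∘ᴾ-vanishes (a ∷ p) p≈0 zero    = trans (horner-zero a (p ∘ᴾ ψ))
      (trans (+-cong (p≈0 0) (trans (*-congˡ (∘ᴾ-vanishes p (p≈0 ∘ suc) 0)) (zeroʳ s))) (+-identityˡ 0#))
    ∘ᴾ-vanishes (a ∷ p) p≈0 (suc n) = horner-degree a (p ∘ᴾ ψ) 0 (∘ᴾ-vanishes p (p≈0 ∘ suc)) n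

  mutual
    -- The local function of derivative, which has no name outside it: once its
    -- arguments are abstracted to variables, unification finds it.
    derivativeFrom : Carrier → Poly → ℕ → Poly → Poly
    derivativeFrom = _

    derivative-unfold : ∀ x a p → derivative (x ∷ a ∷ p) ≡ (1 ×ₙ a) ∷ derivativeFrom x (a ∷ p) 2 p
    derivative-unfold x a p with a ∷ p | 2
    ... | r | n = ≡.refl

  ×ₙ-vanishes : ∀ n {a} → a ≈ 0# → n ×ₙ a ≈ 0#
  ×ₙ-vanishes zero    a≈0 = refl
  ×ₙ-vanishes (suc n) a≈0 = trans (+-cong a≈0 (×ₙ-vanishes n a≈0)) (+-identityˡ 0#)

  derivativeFrom-vanishes : ∀ x r k p → Vanishes p → Vanishes (derivativeFrom x r k p)
  derivativeFrom-vanishes x r k []      p≈0 n       = refl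
  derivativeFrom-vanishes x r k (a ∷ p) p≈0 zero    = ×ₙ-vanishes k (p≈0 0)
  derivativeFrom-vanishes x r k (a ∷ p) p≈0 (suc n) = derivativeFrom-vanishes x r (suc k) p (p≈0 ∘ suc) n

  -- Normal forms over the closure and their conjugates.

  record HasNormalForm (f : Poly) (a h Δ D : Carrier) : Set (ℓ₁ ⊔ ℓ₂) where
    field
      a#0         : a # 0#
      coeff₀      : coeff f 0 ≈ coefficient₀ a h Δ D
      coeff₁      : coeff f 1 ≈ coefficient₁ a h Δ D
      coeff₂      : coeff f 2 ≈ coefficient₂ a h Δ D
      coeff₃      : coeff f 3 ≈ a
      coeff-above : ∀ n → coeff f (4 ℕ.+ n) ≈ 0#

  -- The coefficients of degree 3, 2, 1, 0 determine a, h, Δ, D in this order; the steps for h and Δ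
  -- divide by 3a, which is nonzero in characteristic zero.
  normalForm-unique : ∀ {f g a h Δ D a′ h′ Δ′ D′} → HasNormalForm f a h Δ D → HasNormalForm g a′ h′ Δ′ D′ →
    f ≈ᴾ g → a ≈ a′ × h ≈ h′ × Δ ≈ Δ′ × D ≈ D′
  normalForm-unique {f} {g} {a} {h} {Δ} {D} {a′} {h′} {Δ′} {D′} F G f≈g = a≈ , h≈ , Δ≈ , D≈
    where
    module F = HasNormalForm F
    module G = HasNormalForm G
    a≈ = trans (sym F.coeff₃) (trans (f≈g 3) G.coeff₃)
    3a#0 = 3*#0 F.a#0
    h≈ : h ≈ h′
    h≈ = *-cancelˡ-# 3a#0 (begin
      ⌜ 3 ⌝ * a * h           ≈⟨ solve 2 (λ a h → # 3 :* a :* h := :- (:- (# 3 :* (a :* h)))) refl a h ⟩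
      - coefficient₂ a h Δ D  ≈⟨ -‿cong (trans (sym F.coeff₂) (trans (f≈g 2) G.coeff₂)) ⟩
      - coefficient₂ a′ h′ Δ′ D′ ≈⟨ solve 2 (λ a h → # 3 :* a :* h := :- (:- (# 3 :* (a :* h)))) refl a′ h′ ⟨
      ⌜ 3 ⌝ * a′ * h′         ≈⟨ *-congʳ (*-congˡ a≈) ⟨
      ⌜ 3 ⌝ * a * h′          ∎)
    Δ≈ : Δ ≈ Δ′
    Δ≈ = *-cancelˡ-# 3a#0 (begin
      ⌜ 3 ⌝ * a * Δ                                      ≈⟨ split a h Δ ⟩
      ⌜ 3 ⌝ * a * (h * h) - coefficient₁ a h Δ D         ≈⟨ +-cong (*-cong (*-congˡ a≈) (*-cong h≈ h≈)) (-‿cong (trans (sym F.coeff₁) (trans (f≈g 1) G.coeff₁))) ⟩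
      ⌜ 3 ⌝ * a′ * (h′ * h′) - coefficient₁ a′ h′ Δ′ D′  ≈⟨ split a′ h′ Δ′ ⟨
      ⌜ 3 ⌝ * a′ * Δ′                                    ≈⟨ *-congʳ (*-congˡ a≈) ⟨
      ⌜ 3 ⌝ * a * Δ′                                     ∎)
      where split = solve 3 (λ a h Δ → # 3 :* a :* Δ := # 3 :* a :* (h :* h) :- # 3 :* (a :* (h :* h :- Δ))) refl
    D≈ : D ≈ D′
    D≈ = begin
      D                        ≈⟨ split D _ ⟩
      coefficient₀ a h Δ D - (h - a * (h * (h * h)) + ⌜ 3 ⌝ * (a * (Δ * h)))
        ≈⟨ +-cong (trans (sym F.coeff₀) (trans (f≈g 0) G.coeff₀))
             (-‿cong (+-cong (+-cong h≈ (-‿cong (*-cong a≈ (*-cong h≈ (*-cong h≈ h≈))))) (*-congˡ (*-cong a≈ (*-cong Δ≈ h≈))))) ⟩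
      coefficient₀ a′ h′ Δ′ D′ - (h′ - a′ * (h′ * (h′ * h′)) + ⌜ 3 ⌝ * (a′ * (Δ′ * h′))) ≈⟨ split D′ _ ⟨
      D′                       ∎
      where split = solve 2 (λ D E → D := D :+ E :- E) refl

  -- With t = α⁻¹ and k = αh, f ∘ ψ is t times (φ ∘ f ∘ ψ) - β; written with the
  -- normal form of φ ∘ f ∘ ψ this is a polynomial identity not involving α.
  module _ (D Δ a t k β : Carrier) where

    private
      s h₁ Δ₁ D₁ a′ : Carrier
      s  = - (t * β)
      h₁ = t * k
      Δ₁ = t * t * Δ
      D₁ = t * D
      a′ = a * (t * t)

      C₀ C₁ C₂ : (a h Δ D : Polynomial 6) → Polynomial 6
      C₀ a h Δ D = D :+ (h :- a :* (h :* (h :* h)) :+ # 3 :* (a :* (Δ :* h)))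
      C₁ a h Δ D = # 3 :* (a :* (h :* h :- Δ))
      C₂ a h Δ D = :- (# 3 :* (a :* h))

    inner-identity₀ : coefficient₀ a h₁ Δ₁ D₁ + s * (coefficient₁ a h₁ Δ₁ D₁ + s * (coefficient₂ a h₁ Δ₁ D₁ + s * a))
      ≈ t * (coefficient₀ a′ (k + β) Δ D - β)
    inner-identity₀ = solve 6 (λ D Δ a t k β →
      let s = :- (t :* β); h₁ = t :* k; Δ₁ = t :* t :* Δ; D₁ = t :* D; a′ = a :* (t :* t) in
      C₀ a h₁ Δ₁ D₁ :+ s :* (C₁ a h₁ Δ₁ D₁ :+ s :* (C₂ a h₁ Δ₁ D₁ :+ s :* a)) := t :* (C₀ a′ (k :+ β) Δ D :- β))
      refl D Δ a t k β

    inner-identity₁ : s * (s * (t * a) + t * (coefficient₂ a h₁ Δ₁ D₁ + s * a))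
      + t * (coefficient₁ a h₁ Δ₁ D₁ + s * (coefficient₂ a h₁ Δ₁ D₁ + s * a)) ≈ t * coefficient₁ a′ (k + β) Δ D
    inner-identity₁ = solve 6 (λ D Δ a t k β →
      let s = :- (t :* β); h₁ = t :* k; Δ₁ = t :* t :* Δ; D₁ = t :* D; a′ = a :* (t :* t) in
      s :* (s :* (t :* a) :+ t :* (C₂ a h₁ Δ₁ D₁ :+ s :* a)) :+ t :* (C₁ a h₁ Δ₁ D₁ :+ s :* (C₂ a h₁ Δ₁ D₁ :+ s :* a))
      := t :* C₁ a′ (k :+ β) Δ D)
      refl D Δ a t k β

    inner-identity₂ : s * (t * (t * a)) + t * (s * (t * a) + t * (coefficient₂ a h₁ Δ₁ D₁ + s * a)) ≈ t * coefficient₂ a′ (k + β) Δ D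
    inner-identity₂ = solve 6 (λ D Δ a t k β →
      let s = :- (t :* β); h₁ = t :* k; Δ₁ = t :* t :* Δ; D₁ = t :* D; a′ = a :* (t :* t) in
      s :* (t :* (t :* a)) :+ t :* (s :* (t :* a) :+ t :* (C₂ a h₁ Δ₁ D₁ :+ s :* a)) := t :* C₂ a′ (k :+ β) Δ D)
      refl D Δ a t k β

  module _ {f : Poly} {a h Δ D : Carrier} (F : HasNormalForm f a h Δ D) (α β : Carrier) (α#0 : α # 0#) where

    private
      module F = HasNormalForm F
      t s k a′ h′ Δ′ D′ : Carrier
      t  = inverse α#0
      s  = - (t * β)
      a′ = a * (t * t)
      k  = α * h
      h′ = k + β
      Δ′ = α * α * Δ
      D′ = α * D

      φ ψ : Poly
      φ = affine α β
      ψ = affine⁻¹ α#0 β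

      tα≈1 : t * α ≈ 1#
      tα≈1 = inverse-* α#0

      h≈ : h ≈ t * k
      h≈ = trans (sym (*-identityˡ h)) (trans (*-congʳ (sym tα≈1)) (*-assoc t α h))

      Δ≈ : Δ ≈ t * t * Δ′
      Δ≈ = trans (sym (*-identityˡ Δ)) (trans (*-congʳ (trans (sym (*-identityˡ 1#)) (sym (*-cong tα≈1 tα≈1))))
        (solve 3 (λ t α Δ → t :* α :* (t :* α) :* Δ := t :* t :* (α :* α :* Δ)) refl t α Δ))

      D≈ : D ≈ t * D′
      D≈ = trans (sym (*-identityˡ D)) (trans (*-congʳ (sym tα≈1)) (*-assoc t α D))

      coefficient-cong : ∀ {h₁ Δ₁ D₁ h₂ Δ₂ D₂} → h₁ ≈ h₂ → Δ₁ ≈ Δ₂ → D₁ ≈ D₂ →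
        coefficient₀ a h₁ Δ₁ D₁ ≈ coefficient₀ a h₂ Δ₂ D₂ × coefficient₁ a h₁ Δ₁ D₁ ≈ coefficient₁ a h₂ Δ₂ D₂
        × coefficient₂ a h₁ Δ₁ D₁ ≈ coefficient₂ a h₂ Δ₂ D₂
      coefficient-cong h≈ Δ≈ D≈ =
        +-cong D≈ (+-cong (+-cong h≈ (-‿cong (*-congˡ (*-cong h≈ (*-cong h≈ h≈))))) (*-congˡ (*-congˡ (*-cong Δ≈ h≈)))) ,
        *-congˡ (*-congˡ (+-cong (*-cong h≈ h≈) (-‿cong Δ≈))) , -‿cong (*-congˡ (*-congˡ h≈))

      rescaled = coefficient-cong h≈ Δ≈ D≈
      f₀≈ = trans F.coeff₀ (proj₁ rescaled)
      f₁≈ = trans F.coeff₁ (proj₁ (proj₂ rescaled))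
      f₂≈ = trans F.coeff₂ (proj₂ (proj₂ rescaled))
      f₃≈ = F.coeff₃

    inner-coefficients :
      coeff (f ∘ᴾ ψ) 0 ≈ t * (coefficient₀ a′ h′ Δ′ D′ - β) ×
      coeff (f ∘ᴾ ψ) 1 ≈ t * coefficient₁ a′ h′ Δ′ D′ ×
      coeff (f ∘ᴾ ψ) 2 ≈ t * coefficient₂ a′ h′ Δ′ D′ ×
      coeff (f ∘ᴾ ψ) 3 ≈ t * a′ ×
      (∀ n → coeff (f ∘ᴾ ψ) (4 ℕ.+ n) ≈ 0#)
    inner-coefficients = go f f₀≈ f₁≈ f₂≈ f₃≈ F.coeff-above
      where
      go : ∀ f → coeff f 0 ≈ coefficient₀ a (t * k) (t * t * Δ′) (t * D′) →
        coeff f 1 ≈ coefficient₁ a (t * k) (t * t * Δ′) (t * D′) →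
        coeff f 2 ≈ coefficient₂ a (t * k) (t * t * Δ′) (t * D′) →
        coeff f 3 ≈ a → (∀ n → coeff f (4 ℕ.+ n) ≈ 0#) →
        coeff (f ∘ᴾ ψ) 0 ≈ t * (coefficient₀ a′ h′ Δ′ D′ - β) ×
        coeff (f ∘ᴾ ψ) 1 ≈ t * coefficient₁ a′ h′ Δ′ D′ ×
        coeff (f ∘ᴾ ψ) 2 ≈ t * coefficient₂ a′ h′ Δ′ D′ ×
        coeff (f ∘ᴾ ψ) 3 ≈ t * a′ ×
        (∀ n → coeff (f ∘ᴾ ψ) (4 ℕ.+ n) ≈ 0#)
      -- The list is taken apart so that Horner's scheme unfolds; with fewer than four entries the
      -- coefficient of degree 3 would be 0, against `F.a#0`.
      go [] _ _ _ f₃≈ _ = ⊥-elim (#⇒≉ F.a#0 (sym f₃≈))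
      go (_ ∷ []) _ _ _ f₃≈ _ = ⊥-elim (#⇒≉ F.a#0 (sym f₃≈))
      go (_ ∷ _ ∷ []) _ _ _ f₃≈ _ = ⊥-elim (#⇒≉ F.a#0 (sym f₃≈))
      go (_ ∷ _ ∷ _ ∷ []) _ _ _ f₃≈ _ = ⊥-elim (#⇒≉ F.a#0 (sym f₃≈))
      go (w ∷ z ∷ y ∷ x ∷ p) f₀≈ f₁≈ f₂≈ f₃≈ p≈0 =
        (begin
          coeff r₀ 0                                       ≈⟨ horner-zero t s w r₁ ⟩
          w + s * coeff r₁ 0                               ≈⟨ +-cong f₀≈ (*-congˡ r₁-0) ⟩
          _                                                ≈⟨ inner-identity₀ D′ Δ′ a t k β ⟩
          t * (coefficient₀ a′ h′ Δ′ D′ - β)               ∎) ,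
        (begin
          coeff r₀ 1                                       ≈⟨ horner-suc t s w r₁ 0 ⟩
          s * coeff r₁ 1 + t * coeff r₁ 0                  ≈⟨ +-cong (*-congˡ r₁-1) (*-congˡ r₁-0) ⟩
          _                                                ≈⟨ inner-identity₁ D′ Δ′ a t k β ⟩
          t * coefficient₁ a′ h′ Δ′ D′                     ∎) ,
        (begin
          coeff r₀ 2                                       ≈⟨ horner-suc t s w r₁ 1 ⟩
          s * coeff r₁ 2 + t * coeff r₁ 1                  ≈⟨ +-cong (*-congˡ r₁-2) (*-congˡ r₁-1) ⟩
          _                                                ≈⟨ inner-identity₂ D′ Δ′ a t k β ⟩
          t * coefficient₂ a′ h′ Δ′ D′                     ∎) ,
        (begin
          coeff r₀ 3                                       ≈⟨ horner-suc t s w r₁ 2 ⟩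
          s * coeff r₁ 3 + t * coeff r₁ 2                  ≈⟨ +-cong (trans (*-congˡ (r₁-above 0)) (zeroʳ s)) (*-congˡ r₁-2) ⟩
          0# + t * (t * (t * a))                           ≈⟨ +-identityˡ _ ⟩
          t * (t * (t * a))                                ≈⟨ solve 2 (λ a t → t :* (t :* (t :* a)) := t :* (a :* (t :* t))) refl a t ⟩
          t * a′                                           ∎) ,
        horner-degree t s w r₁ 3 r₁-above
        where
        r₀ = (w ∷ z ∷ y ∷ x ∷ p) ∘ᴾ ψ
        r₁ = (z ∷ y ∷ x ∷ p) ∘ᴾ ψ
        r₂ = (y ∷ x ∷ p) ∘ᴾ ψ
        r₃ = (x ∷ p) ∘ᴾ ψ
        r₄ = p ∘ᴾ ψ
        r₄≈0 : Vanishes r₄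
        r₄≈0 = ∘ᴾ-vanishes t s p p≈0
        r₃-above : ∀ n → coeff r₃ (1 ℕ.+ n) ≈ 0#
        r₃-above = horner-degree t s x r₄ 0 r₄≈0
        r₂-above : ∀ n → coeff r₂ (2 ℕ.+ n) ≈ 0#
        r₂-above = horner-degree t s y r₃ 1 r₃-above
        r₁-above : ∀ n → coeff r₁ (3 ℕ.+ n) ≈ 0#
        r₁-above = horner-degree t s z r₂ 2 r₂-above
        r₃-0 : coeff r₃ 0 ≈ a
        r₃-0 = trans (horner-zero t s x r₄) (trans (+-cong f₃≈ (trans (*-congˡ (r₄≈0 0)) (zeroʳ s))) (+-identityʳ a))
        r₂-0 : coeff r₂ 0 ≈ coefficient₂ a (t * k) (t * t * Δ′) (t * D′) + s * a
        r₂-0 = trans (horner-zero t s y r₃) (+-cong f₂≈ (*-congˡ r₃-0))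
        r₂-1 : coeff r₂ 1 ≈ t * a
        r₂-1 = trans (horner-suc t s y r₃ 0) (trans (+-cong (trans (*-congˡ (r₃-above 0)) (zeroʳ s)) (*-congˡ r₃-0)) (+-identityˡ _))
        r₁-0 : coeff r₁ 0 ≈ coefficient₁ a (t * k) (t * t * Δ′) (t * D′) + s * (coefficient₂ a (t * k) (t * t * Δ′) (t * D′) + s * a)
        r₁-0 = trans (horner-zero t s z r₂) (+-cong f₁≈ (*-congˡ r₂-0))
        r₁-1 : coeff r₁ 1 ≈ s * (t * a) + t * (coefficient₂ a (t * k) (t * t * Δ′) (t * D′) + s * a)
        r₁-1 = trans (horner-suc t s z r₂ 0) (+-cong (*-congˡ r₂-1) (*-congˡ r₂-0))
        r₁-2 : coeff r₁ 2 ≈ t * (t * a)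
        r₁-2 = trans (horner-suc t s z r₂ 1) (trans (+-cong (trans (*-congˡ (r₂-above 0)) (zeroʳ s)) (*-congˡ r₂-1)) (+-identityˡ _))

    -- In the coordinate αz + β the midpoint of the critical points moves to αh + β, their squared
    -- half-difference is multiplied by α², the displacement D by α, and the leading coefficient by
    -- α⁻².
    conjugate-normalForm : HasNormalForm (φ ∘ᴾ f ∘ᴾ ψ) a′ h′ Δ′ D′
    conjugate-normalForm = record
      { a#0         = invertible⇒#0 {y = inverse F.a#0 * (α * α)} (begin
          inverse F.a#0 * (α * α) * (a * (t * t)) ≈⟨ solve 4 (λ i α a t → i :* (α :* α) :* (a :* (t :* t)) := (i :* a) :* ((t :* α) :* (t :* α))) refl (inverse F.a#0) α a t ⟩
          (inverse F.a#0 * a) * ((t * α) * (t * α)) ≈⟨ *-cong (inverse-* F.a#0) (*-cong tα≈1 tα≈1) ⟩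
          1# * (1# * 1#)                          ≈⟨ trans (*-identityˡ _) (*-identityˡ _) ⟩
          1#                                      ∎)
      ; coeff₀      = begin
          coeff (φ ∘ᴾ g) 0                       ≈⟨ outer-zero ⟩
          β + coeff g 0 * α                      ≈⟨ +-congˡ (unscale (proj₁ inner)) ⟩
          β + (coefficient₀ a′ h′ Δ′ D′ - β)     ≈⟨ solve 2 (λ β x → β :+ (x :- β) := x) refl β _ ⟩
          coefficient₀ a′ h′ Δ′ D′               ∎
      ; coeff₁      = trans (outer-suc 0) (unscale (proj₁ (proj₂ inner)))
      ; coeff₂      = trans (outer-suc 1) (unscale (proj₁ (proj₂ (proj₂ inner))))
      ; coeff₃      = trans (outer-suc 2) (unscale (proj₁ (proj₂ (proj₂ (proj₂ inner)))))
      ; coeff-above = λ n → trans (outer-suc (3 ℕ.+ n)) (trans (*-congʳ (proj₂ (proj₂ (proj₂ (proj₂ inner))) n)) (zeroˡ α))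
      }
      where
      inner = inner-coefficients
      g = f ∘ᴾ ψ

      unscale : ∀ {x y} → x ≈ t * y → x * α ≈ y
      unscale {x} {y} x≈ty = begin
        x * α       ≈⟨ *-congʳ x≈ty ⟩
        t * y * α   ≈⟨ solve 3 (λ t y α → t :* y :* α := t :* α :* y) refl t y α ⟩
        t * α * y   ≈⟨ *-congʳ tα≈1 ⟩
        1# * y      ≈⟨ *-identityˡ y ⟩
        y           ∎

      constant = (α ∷ []) +ᴾ g *ᴾ []

      g*[]≈0 : ∀ n → coeff (g *ᴾ []) n ≈ 0#
      g*[]≈0 n = trans (coeff-*ᴾ-constant g [] refl (λ _ → refl) n) (zeroʳ _)

      constant₀ : coeff constant 0 ≈ α
      constant₀ = trans (coeff-+ᴾ (α ∷ []) (g *ᴾ []) 0) (trans (+-congˡ (g*[]≈0 0)) (+-identityʳ α))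

      constant₊ : ∀ n → coeff constant (suc n) ≈ 0#
      constant₊ n = trans (coeff-+ᴾ (α ∷ []) (g *ᴾ []) (suc n)) (trans (+-identityˡ _) (g*[]≈0 (suc n)))

      outer-zero : coeff (φ ∘ᴾ g) 0 ≈ β + coeff g 0 * α
      outer-zero = trans (coeff-+ᴾ (β ∷ []) (g *ᴾ constant) 0) (+-congˡ (coeff-*ᴾ-constant g constant constant₀ constant₊ 0))

      outer-suc : ∀ n → coeff (φ ∘ᴾ g) (suc n) ≈ coeff g (suc n) * α
      outer-suc n = trans (coeff-+ᴾ (β ∷ []) (g *ᴾ constant) (suc n))
        (trans (+-identityˡ _) (coeff-*ᴾ-constant g constant constant₀ constant₊ (suc n)))

  normalForm-≈ᴾ : ∀ {f g a h Δ D a′ h′ Δ′ D′} → HasNormalForm f a h Δ D → HasNormalForm g a′ h′ Δ′ D′ →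
    a ≈ a′ → h ≈ h′ → Δ ≈ Δ′ → D ≈ D′ → f ≈ᴾ g
  normalForm-≈ᴾ F G a≈ h≈ Δ≈ D≈ = λ where
      0 → trans F.coeff₀ (trans (+-cong D≈ (+-cong (+-cong h≈ (-‿cong (*-cong a≈ (*-cong h≈ (*-cong h≈ h≈)))))
            (*-congˡ (*-cong a≈ (*-cong Δ≈ h≈))))) (sym G.coeff₀))
      1 → trans F.coeff₁ (trans (*-congˡ (*-cong a≈ (+-cong (*-cong h≈ h≈) (-‿cong Δ≈)))) (sym G.coeff₁))
      2 → trans F.coeff₂ (trans (-‿cong (*-congˡ (*-cong a≈ h≈))) (sym G.coeff₂))
      3 → trans F.coeff₃ (trans a≈ (sym G.coeff₃))
      (suc (suc (suc (suc n)))) → trans (F.coeff-above n) (sym (G.coeff-above n))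
    where
    module F = HasNormalForm F
    module G = HasNormalForm G

  -- Conjugacy expressed by the invariants aΔ and aD².

  private
    rescale-linear : ∀ {t α} → t * α ≈ 1# → ∀ a x → a * (t * t) * (α * α * x) ≈ a * x
    rescale-linear {t} {α} tα≈1 a x = begin
      a * (t * t) * (α * α * x)        ≈⟨ solve 4 (λ a t α x → a :* (t :* t) :* (α :* α :* x) := t :* α :* (t :* α) :* (a :* x)) refl a t α x ⟩
      t * α * (t * α) * (a * x)        ≈⟨ *-congʳ (trans (*-cong tα≈1 tα≈1) (*-identityˡ 1#)) ⟩
      1# * (a * x)                     ≈⟨ *-identityˡ _ ⟩
      a * x                            ∎

    rescale-quadratic : ∀ {t α} → t * α ≈ 1# → ∀ a x → a * (t * t) * (α * x * (α * x)) ≈ a * (x * x)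
    rescale-quadratic {t} {α} tα≈1 a x = trans (*-congˡ (solve 2 (λ α x → α :* x :* (α :* x) := α :* α :* (x :* x)) refl α x))
      (rescale-linear tα≈1 a (x * x))

  conjugate⇒invariants : ∀ {f g a h Δ D a′ h′ Δ′ D′} → HasNormalForm f a h Δ D → HasNormalForm g a′ h′ Δ′ D′ →
    Conjugate f g → a * Δ ≈ a′ * Δ′ × a * (D * D) ≈ a′ * (D′ * D′)
  conjugate⇒invariants {a = a} {h} {Δ} {D} {a′} {h′} {Δ′} {D′} F G (α , β , α#0 , g≈) =
    invariants (normalForm-unique G (conjugate-normalForm F α β α#0) g≈)
    where
    t = inverse α#0
    invariants : a′ ≈ a * (t * t) × h′ ≈ α * h + β × Δ′ ≈ α * α * Δ × D′ ≈ α * D → a * Δ ≈ a′ * Δ′ × a * (D * D) ≈ a′ * (D′ * D′)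
    invariants (a≈ , _ , Δ≈ , D≈) =
      sym (trans (*-cong a≈ Δ≈) (rescale-linear (inverse-* α#0) a Δ)) ,
      sym (trans (*-cong a≈ (*-cong D≈ D≈)) (rescale-quadratic (inverse-* α#0) a D))

  squareRoot : ∀ x → ∃[ y ] y * y ≈ x
  squareRoot x = proj₁ root , is-root (proj₁ root) (proj₂ root)
    where
    p : Poly
    p = - x ∷ 0# ∷ 1# ∷ []
    degree : ∀ m → 2 ℕ.< m → coeff p m ≈ 0#
    degree (suc (suc (suc m))) _ = refl
    degree 2 (ℕ.s≤s (ℕ.s≤s ()))
    degree 1 (ℕ.s≤s ())
    root = algebraicallyClosed p 1 (1#0 , degree)
    is-root : ∀ y → eval p y ≈ 0# → y * y ≈ x
    is-root y y-root = begin
      y * y                                      ≈⟨ *-congˡ (sym (trans (*-congˡ (trans (+-congˡ (zeroʳ y)) (+-identityʳ 1#))) (*-identityʳ y))) ⟩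
      y * (y * (1# + y * 0#))                    ≈⟨ *-congˡ (sym (+-identityˡ _)) ⟩
      y * (0# + y * (1# + y * 0#))               ≈⟨ solve 2 (λ x z → z := :- x :+ z :+ x) refl x _ ⟩
      - x + y * (0# + y * (1# + y * 0#)) + x     ≈⟨ +-congʳ y-root ⟩
      0# + x                                     ≈⟨ +-identityˡ x ⟩
      x                                          ∎

  private
    quotient-squared : ∀ {i D a a′ D′} → i * D ≈ 1# → a * (D * D) ≈ a′ * (D′ * D′) → D′ * i * (D′ * i) * a′ ≈ a
    quotient-squared {i} {D} {a} {a′} {D′} iD≈1 e≈ = begin
      D′ * i * (D′ * i) * a′      ≈⟨ solve 3 (λ D′ i a′ → D′ :* i :* (D′ :* i) :* a′ := a′ :* (D′ :* D′) :* (i :* i)) refl D′ i a′ ⟩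
      a′ * (D′ * D′) * (i * i)    ≈⟨ *-congʳ e≈ ⟨
      a * (D * D) * (i * i)       ≈⟨ solve 3 (λ a D i → a :* (D :* D) :* (i :* i) := a :* (i :* D :* (i :* D))) refl a D i ⟩
      a * (i * D * (i * D))       ≈⟨ *-congˡ (trans (*-cong iD≈1 iD≈1) (*-identityˡ 1#)) ⟩
      a * 1#                      ≈⟨ *-identityʳ a ⟩
      a                           ∎

    rescale-inverse : ∀ {t α a a′} → t * α ≈ 1# → α * α * a′ ≈ a → a′ ≈ a * (t * t)
    rescale-inverse {t} {α} {a} {a′} tα≈1 α²a′≈a = begin
      a′                         ≈⟨ *-identityʳ a′ ⟨
      a′ * 1#                    ≈⟨ *-congˡ (trans (*-cong tα≈1 tα≈1) (*-identityˡ 1#)) ⟨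
      a′ * (t * α * (t * α))     ≈⟨ solve 3 (λ a′ t α → a′ :* (t :* α :* (t :* α)) := α :* α :* a′ :* (t :* t)) refl a′ t α ⟩
      α * α * a′ * (t * t)       ≈⟨ *-congʳ α²a′≈a ⟩
      a * (t * t)                ∎

    complete : ∀ x y → x ≈ y + (x - y)
    complete = solve 2 (λ x y → x := y :+ (x :- y)) refl

  invariants⇒conjugate : ∀ {f g a h Δ D a′ h′ Δ′ D′} → HasNormalForm f a h Δ D → HasNormalForm g a′ h′ Δ′ D′ →
    a * Δ ≈ a′ * Δ′ → a * (D * D) ≈ a′ * (D′ * D′) → Conjugate f g
  invariants⇒conjugate {f} {g} {a} {h} {Δ} {D} {a′} {h′} {Δ′} {D′} F G A≈ e≈ = conclude (scaling (D #? 0#))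
    where
    a#0 = HasNormalForm.a#0 F
    a′#0 = HasNormalForm.a#0 G

    scaling : Dec (D # 0#) → ∃[ α ] α * α * a′ ≈ a × α * D ≈ D′
    -- For D nonzero the scaling is forced to be D′/D, and aD² = a′D′² says exactly that its square
    -- is a/a′.
    scaling (yes D#0) = D′ * inverse D#0 , quotient-squared (inverse-* D#0) e≈ ,
      trans (*-assoc D′ _ D) (trans (*-congˡ (inverse-* D#0)) (*-identityʳ D′))
    -- For D = 0 the second invariant vanishes, so D′ = 0 too, and either square root of a/a′ will
    -- do.
    scaling (no ¬D#0) = α , trans (*-congʳ α²≈) (trans (*-assoc a _ a′) (trans (*-congˡ (inverse-* a′#0)) (*-identityʳ a))) ,
      trans (*-congˡ D≈0) (trans (zeroʳ α) (sym D′≈0))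
      where
      α = proj₁ (squareRoot (a * inverse a′#0))
      α²≈ = proj₂ (squareRoot (a * inverse a′#0))
      D≈0 = ¬#0⇒≈0 ¬D#0
      D′≈0 : D′ ≈ 0#
      D′≈0 = square≈0 (*-cancelˡ-# a′#0 (trans (sym e≈)
        (trans (*-congˡ (trans (*-congʳ D≈0) (zeroˡ D))) (trans (zeroʳ a) (sym (zeroʳ a′))))))

    conclude : ∃[ α ] α * α * a′ ≈ a × α * D ≈ D′ → Conjugate f g
    conclude (α , α²a′≈a , αD≈D′) = byCases (α #? 0#)
      where
      Δ≈ : Δ′ ≈ α * α * Δ
      Δ≈ = *-cancelˡ-# a′#0 (begin
        a′ * Δ′            ≈⟨ A≈ ⟨
        a * Δ              ≈⟨ *-congʳ α²a′≈a ⟨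
        α * α * a′ * Δ     ≈⟨ solve 3 (λ α a′ Δ → α :* α :* a′ :* Δ := a′ :* (α :* α :* Δ)) refl α a′ Δ ⟩
        a′ * (α * α * Δ)   ∎)
      byCases : Dec (α # 0#) → Conjugate f g
      byCases (no ¬α#0) = ⊥-elim (#⇒≉ a#0 (trans (sym α²a′≈a) (trans (*-congʳ (trans (*-congʳ (¬#0⇒≈0 ¬α#0)) (zeroˡ α))) (zeroˡ a′))))
      byCases (yes α#0) = α , h′ - α * h , α#0 ,
        normalForm-≈ᴾ G (conjugate-normalForm F α (h′ - α * h) α#0)
          (rescale-inverse (inverse-* α#0) α²a′≈a) (complete h′ (α * h)) Δ≈ (sym αD≈D′)

  -- Orbits

  iterate-suc : ∀ {A : Set c} (f : A → A) x n → iterate f x (suc n) ≡ f (iterate f x n)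
  iterate-suc f x zero    = ≡.refl
  iterate-suc f x (suc n) = iterate-suc f (f x) n

  iterate-cong : ∀ f {x y} n → x ≈ y → iterate (eval f) x n ≈ iterate (eval f) y n
  iterate-cong f zero    x≈y = x≈y
  iterate-cong f (suc n) x≈y = iterate-cong f n (eval-cong f x≈y)

  preperiodic⇒finite : ∀ f α {i j} → i ℕ.< j → iterate (eval f) α i ≈ iterate (eval f) α j → Finite (Orbit f α)
  preperiodic⇒finite f α {i} {j} i<j Xᵢ≈Xⱼ = applyUpTo X j , λ x → mk⇔ to from
    where
    X = iterate (eval f) α
    reduce : ∀ n → ∃[ m ] m ℕ.< j × X n ≈ X m
    reduce zero    = 0 , ℕ.≤-<-trans ℕ.z≤n i<j , refl
    reduce (suc n) with m , m<j , Xₙ≈Xₘ ← reduce n with suc m ℕ.<? j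
    ... | yes 1+m<j = suc m , 1+m<j , next
      where next = trans (reflexive (iterate-suc (eval f) α n)) (trans (eval-cong f Xₙ≈Xₘ) (reflexive (≡.sym (iterate-suc (eval f) α m))))
    -- The successor of the last index below `j` is `j` itself, which wraps around to `i`.
    ... | no  1+m≮j = i , i<j , trans next (trans (reflexive (≡.cong X (ℕ.≤-antisym m<j (ℕ.≮⇒≥ 1+m≮j)))) (sym Xᵢ≈Xⱼ))
      where next = trans (reflexive (iterate-suc (eval f) α n)) (trans (eval-cong f Xₙ≈Xₘ) (reflexive (≡.sym (iterate-suc (eval f) α m))))
    to : ∀ {x} → Orbit f α x → x ∈ applyUpTo X j
    to (n , x≈Xₙ) with m , m<j , Xₙ≈Xₘ ← reduce n = ∈-resp-≈ setoid (sym (trans x≈Xₙ Xₙ≈Xₘ)) (∈-applyUpTo⁺ setoid X m<j)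
    from : ∀ {x} → x ∈ applyUpTo X j → Orbit f α x
    from x∈ with n , _ , x≈Xₙ ← ∈-applyUpTo⁻ setoid X x∈ = n , x≈Xₙ

  -- The two orbits have to repeat at the same pair of times. Hence the pigeonhole principle is
  -- applied to pairs of positions in `xs` and `ys`, over one more consecutive time than there are
  -- pairs.
  finite⇒recurrent : ∀ f α α′ → Finite (Orbit f α) → Finite (Orbit f α′) → ∀ n →
    ∃[ i ] ∃[ k ] iterate (eval f) α (i ℕ.+ n) ≈ iterate (eval f) α (suc k ℕ.+ (i ℕ.+ n))
                × iterate (eval f) α′ (i ℕ.+ n) ≈ iterate (eval f) α′ (suc k ℕ.+ (i ℕ.+ n))
  finite⇒recurrent f α α′ (xs , orbit⇔xs) (ys , orbit⇔ys) n = conclude (pigeonhole (ℕ.n<1+n _) codes)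
    where
    X = iterate (eval f) α
    Y = iterate (eval f) α′
    X∈ : ∀ m → X m ∈ xs
    X∈ m = Equivalence.to (orbit⇔xs (X m)) (m , refl)
    Y∈ : ∀ m → Y m ∈ ys
    Y∈ m = Equivalence.to (orbit⇔ys (Y m)) (m , refl)
    codes : Fin (suc (length xs ℕ.* length ys)) → Fin (length xs ℕ.* length ys)
    codes k = combine (index (X∈ (toℕ k ℕ.+ n))) (index (Y∈ (toℕ k ℕ.+ n)))
    same : ∀ {zs} {x y : Carrier} (x∈ : x ∈ zs) (y∈ : y ∈ zs) → index x∈ ≡ index y∈ → x ≈ y
    same {zs} x∈ y∈ eq = trans (lookup-index x∈) (trans (reflexive (≡.cong (List.lookup zs) eq)) (sym (lookup-index y∈)))
    conclude : (∃[ i ] ∃[ j ] i Fin.< j × codes i ≡ codes j) → _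
    conclude (i , j , i<j , eq) with k , 1+i+k≡j ← ℕ.m≤n⇒∃[o]m+o≡n i<j =
      toℕ i , k ,
      trans (same (X∈ _) (X∈ _) (proj₁ both)) (reflexive (≡.cong X j+n≡)) ,
      trans (same (Y∈ _) (Y∈ _) (proj₂ both)) (reflexive (≡.cong Y j+n≡))
      where
      both = combine-injective (index (X∈ (toℕ i ℕ.+ n))) (index (Y∈ (toℕ i ℕ.+ n))) (index (X∈ (toℕ j ℕ.+ n))) (index (Y∈ (toℕ j ℕ.+ n))) eq
      j+n≡ : toℕ j ℕ.+ n ≡ suc k ℕ.+ (toℕ i ℕ.+ n)
      j+n≡ = ≡.trans (≡.cong (ℕ._+ n) (≡.trans (≡.sym 1+i+k≡j) (≡.cong suc (ℕ.+-comm (toℕ i) k)))) (ℕ.+-assoc (suc k) (toℕ i) n)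

  -- With `drop 1` the Horner step also holds for the empty list, so four coefficients can be split
  -- off without distinguishing the length of the list.
  eval-drop : ∀ p x → eval p x ≈ coeff p 0 + x * eval (drop 1 p) x
  eval-drop []      x = sym (trans (+-identityˡ _) (zeroʳ x))
  eval-drop (a ∷ p) x = refl

  coeff-drop : ∀ p n → coeff (drop 1 p) n ≡ coeff p (suc n)
  coeff-drop []      n = ≡.refl
  coeff-drop (a ∷ p) n = ≡.refl

  eval-linear+ : ∀ p x {y} → eval (drop 1 p) x ≈ y → eval p x ≈ coeff p 0 + x * y
  eval-linear+ p x eq = trans (eval-drop p x) (+-congˡ (*-congˡ eq))

  private
    expand : ∀ a h Δ D y → coefficient₀ a h Δ D + (h + y) * (coefficient₁ a h Δ D + (h + y) * (coefficient₂ a h Δ D + (h + y) * a))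
      ≈ h + (a * (y * (y * y)) - ⌜ 3 ⌝ * (a * (Δ * y)) + D)
    expand = solve 5 (λ a h Δ D y → (D :+ (h :- a :* (h :* (h :* h)) :+ # 3 :* (a :* (Δ :* h)))) :+ (h :+ y) :*
      (# 3 :* (a :* (h :* h :- Δ)) :+ (h :+ y) :* (:- (# 3 :* (a :* h)) :+ (h :+ y) :* a))
      := h :+ (a :* (y :* (y :* y)) :- # 3 :* (a :* (Δ :* y)) :+ D)) refl

    expand-derivative : ∀ a h Δ x → ⌜ 3 ⌝ * (a * (h * h - Δ)) + x * ((- (⌜ 3 ⌝ * (a * h)) + - (⌜ 3 ⌝ * (a * h))) + x * (a + (a + a)))
      ≈ ⌜ 3 ⌝ * a * ((x - h) * (x - h) - Δ)
    expand-derivative = solve 4 (λ a h Δ x → # 3 :* (a :* (h :* h :- Δ)) :+ x :* ((:- (# 3 :* (a :* h)) :+ :- (# 3 :* (a :* h))) :+ x :* (a :+ (a :+ a)))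
      := # 3 :* a :* ((x :- h) :* (x :- h) :- Δ)) refl

    -- An identity for arbitrary δ: what is left over is a multiple of δ² - Δ and vanishes at a
    -- critical point. It shows that δ enters the new state only through its square.
    cubic-on-state : ∀ a Δ D δ u v → let open Orbit (a * Δ) (a * (D * D)); w = δ * u + D * v in
      a * (w * (w * w)) - ⌜ 3 ⌝ * (a * (Δ * w)) + D
      ≈ (δ * proj₁ (step (u , v)) + D * proj₂ (step (u , v))) + (δ * δ - Δ) * (a * (δ * (u * (u * u))) + ⌜ 3 ⌝ * (a * (D * (u * (u * v)))))
    cubic-on-state = solve 6 (λ a Δ D δ u v →
      let w = δ :* u :+ D :* v
          A = a :* Δ
          e = a :* (D :* D)
          P = A :* (u :* u)
          Q = e :* (v :* v)
          u′ = u :* (P :+ # 3 :* Q :- # 3 :* A)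
          v′ = v :* (# 3 :* P :+ Q :- # 3 :* A) :+ # 1
      in a :* (w :* (w :* w)) :- # 3 :* (a :* (Δ :* w)) :+ D
         := (δ :* u′ :+ D :* v′) :+ (δ :* δ :- Δ) :* (a :* (δ :* (u :* (u :* u))) :+ # 3 :* (a :* (D :* (u :* (u :* v)))))) refl

    initial : ∀ h δ D → h + δ ≈ h + (δ * ⌜ 1 ⌝ + D * ⌜ 0 ⌝)
    initial = solve 3 (λ h δ D → h :+ δ := h :+ (δ :* # 1 :+ D :* # 0)) refl

    -- The two critical orbits h ± δu + Dv determine Au² and ev², where A = aδ² and e = aD².
    P-from-orbits : ∀ a h D δ u v → let X = h + (δ * u + D * v); Y = h + (- δ * u + D * v); w = ι ℚ.½ * (X - Y) in
      a * (δ * δ) * (u * u) ≈ a * (w * w)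
    P-from-orbits = solve 6 (λ a h D δ u v → let X = h :+ (δ :* u :+ D :* v); Y = h :+ (:- δ :* u :+ D :* v); w = con ℚ.½ :* (X :- Y) in
      a :* (δ :* δ) :* (u :* u) := a :* (w :* w)) refl

    Q-from-orbits : ∀ a h D δ u v → let X = h + (δ * u + D * v); Y = h + (- δ * u + D * v); w = ι ℚ.½ * (X + Y) - h in
      a * (D * D) * (v * v) ≈ a * (w * w)
    Q-from-orbits = solve 6 (λ a h D δ u v → let X = h :+ (δ :* u :+ D :* v); Y = h :+ (:- δ :* u :+ D :* v); w = con ℚ.½ :* (X :+ Y) :- h in
      a :* (D :* D) :* (v :* v) := a :* (w :* w)) refl

    complete-square : ∀ h α → α ≈ h + (α - h)
    complete-square = solve 2 (λ h α → α := h :+ (α :- h)) refl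

    cancel-left : ∀ h δ → (h + δ) - h ≈ δ
    cancel-left = solve 2 (λ h δ → (h :+ δ) :- h := δ) refl

    square-neg : ∀ δ → - δ * - δ ≈ δ * δ
    square-neg = solve 1 (λ δ → :- δ :* :- δ := δ :* δ) refl

  module _ {f : Poly} {a h Δ D : Carrier} (F : HasNormalForm f a h Δ D) where

    private
      module F = HasNormalForm F

    open Orbit (a * Δ) (a * (D * D))

    eval-normalForm : ∀ y → eval f (h + y) ≈ h + (a * (y * (y * y)) - ⌜ 3 ⌝ * (a * (Δ * y)) + D)
    eval-normalForm y = trans
      (eval-linear+ f x (eval-linear+ f₁ x (eval-linear+ f₂ x (trans (eval-linear+ f₃ x (eval-vanishes f₄ f₄≈0 x)) (trans (+-congˡ (zeroʳ x)) (+-identityʳ _))))))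
      (trans (+-cong F.coeff₀ (*-congˡ (+-cong (trans (reflexive (coeff-drop f 0)) F.coeff₁)
        (*-congˡ (+-cong (trans (reflexive (≡.trans (coeff-drop f₁ 0) (coeff-drop f 1))) F.coeff₂)
        (*-congˡ (trans (reflexive (≡.trans (coeff-drop f₂ 0) (≡.trans (coeff-drop f₁ 1) (coeff-drop f 2)))) F.coeff₃)))))))
        (expand a h Δ D y))
      where
      x = h + y
      f₁ = drop 1 f
      f₂ = drop 1 f₁
      f₃ = drop 1 f₂
      f₄ = drop 1 f₃
      f₄≈0 : Vanishes f₄
      f₄≈0 n = trans (reflexive (≡.trans (coeff-drop f₃ n) (≡.trans (coeff-drop f₂ (1 ℕ.+ n)) (≡.trans (coeff-drop f₁ (2 ℕ.+ n)) (coeff-drop f (3 ℕ.+ n)))))) (F.coeff-above n)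

    eval-derivative : ∀ x → eval (derivative f) x ≈ ⌜ 3 ⌝ * a * ((x - h) * (x - h) - Δ)
    eval-derivative x = go f F.coeff₁ F.coeff₂ F.coeff₃ F.coeff-above
      where
      go : ∀ f → coeff f 1 ≈ coefficient₁ a h Δ D → coeff f 2 ≈ coefficient₂ a h Δ D → coeff f 3 ≈ a →
        (∀ n → coeff f (4 ℕ.+ n) ≈ 0#) → eval (derivative f) x ≈ ⌜ 3 ⌝ * a * ((x - h) * (x - h) - Δ)
      go [] _ _ f₃≈ _ = ⊥-elim (#⇒≉ F.a#0 (sym f₃≈))
      go (_ ∷ []) _ _ f₃≈ _ = ⊥-elim (#⇒≉ F.a#0 (sym f₃≈))
      go (_ ∷ _ ∷ []) _ _ f₃≈ _ = ⊥-elim (#⇒≉ F.a#0 (sym f₃≈))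
      go (_ ∷ _ ∷ _ ∷ []) _ _ f₃≈ _ = ⊥-elim (#⇒≉ F.a#0 (sym f₃≈))
      go (w ∷ z ∷ y ∷ b ∷ p) f₁≈ f₂≈ f₃≈ p≈0 = begin
        eval (derivative (w ∷ z ∷ y ∷ b ∷ p)) x
          ≈⟨ reflexive (≡.cong (λ q → eval q x) (derivative-unfold w z (y ∷ b ∷ p))) ⟩
        1 ×ₙ z + x * (2 ×ₙ y + x * (3 ×ₙ b + x * eval (derivativeFrom w (z ∷ y ∷ b ∷ p) 4 p) x))
          ≈⟨ +-cong (trans (+-identityʳ z) f₁≈) (*-congˡ (+-cong (+-cong f₂≈ (trans (+-identityʳ y) f₂≈))
               (*-congˡ (trans (+-cong (+-cong f₃≈ (+-cong f₃≈ (trans (+-identityʳ b) f₃≈)))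
                 (trans (*-congˡ (eval-vanishes (derivativeFrom w (z ∷ y ∷ b ∷ p) 4 p) (derivativeFrom-vanishes w (z ∷ y ∷ b ∷ p) 4 p p≈0) x)) (zeroʳ x))) (+-identityʳ _))))) ⟩
        coefficient₁ a h Δ D + x * ((coefficient₂ a h Δ D + coefficient₂ a h Δ D) + x * (a + (a + a)))
          ≈⟨ expand-derivative a h Δ x ⟩
        ⌜ 3 ⌝ * a * ((x - h) * (x - h) - Δ) ∎

    critical⇒ : ∀ α → CriticalPoint f α → (α - h) * (α - h) ≈ Δ
    critical⇒ α critical = x-y≈0⇒x≈y _ _ (*-cancelˡ-# (3*#0 F.a#0) (trans (sym (eval-derivative α)) (trans critical (sym (zeroʳ _)))))

    ⇒critical : ∀ δ → δ * δ ≈ Δ → CriticalPoint f (h + δ)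
    ⇒critical δ δ²≈Δ = trans (eval-derivative (h + δ)) (trans (*-congˡ (trans (+-congʳ
      (trans (*-cong (cancel-left h δ) (cancel-left h δ)) δ²≈Δ)) (-‿inverseʳ Δ))) (zeroʳ _))

    -- Both square roots of Δ are allowed, and the state orbit is the same for δ and -δ; this is how
    -- one rational orbit follows the two critical orbits at once.
    iterate-critical : ∀ δ → δ * δ ≈ Δ → ∀ n → iterate (eval f) (h + δ) n ≈ h + (δ * proj₁ (orbit n) + D * proj₂ (orbit n))
    iterate-critical δ δ²≈Δ zero    = initial h δ D
    iterate-critical δ δ²≈Δ (suc n) = begin
      iterate (eval f) (h + δ) (suc n)                               ≈⟨ reflexive (iterate-suc (eval f) (h + δ) n) ⟩
      eval f (iterate (eval f) (h + δ) n)                            ≈⟨ eval-cong f (iterate-critical δ δ²≈Δ n) ⟩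
      eval f (h + (δ * proj₁ (orbit n) + D * proj₂ (orbit n)))       ≈⟨ eval-normalForm _ ⟩
      _                                                              ≈⟨ +-congˡ (cubic-on-state a Δ D δ (proj₁ (orbit n)) (proj₂ (orbit n))) ⟩
      h + ((δ * proj₁ (orbit (suc n)) + D * proj₂ (orbit (suc n))) + (δ * δ - Δ) * _)
        ≈⟨ +-congˡ (trans (+-congˡ (trans (*-congʳ (trans (+-congʳ δ²≈Δ) (-‿inverseʳ Δ))) (zeroˡ _))) (+-identityʳ _)) ⟩
      h + (δ * proj₁ (orbit (suc n)) + D * proj₂ (orbit (suc n)))    ∎

    postcriticallyFinite⇒recurrent : PostcriticallyFinite f → Recurrent
    postcriticallyFinite⇒recurrent pcf n = conclude (finite⇒recurrent f (h + δ) (h + - δ) (pcf _ (⇒critical δ δ²≈Δ)) (pcf _ (⇒critical (- δ) -δ²≈Δ)) n)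
      where
      δ = proj₁ (squareRoot Δ)
      δ²≈Δ = proj₂ (squareRoot Δ)
      -δ²≈Δ = trans (square-neg δ) δ²≈Δ
      X = iterate (eval f) (h + δ)
      Y = iterate (eval f) (h + - δ)
      P≈ : ∀ m → P (orbit m) ≈ a * ((ι ℚ.½ * (X m - Y m)) * (ι ℚ.½ * (X m - Y m)))
      P≈ m = trans (*-congʳ (*-congˡ (sym δ²≈Δ))) (trans (P-from-orbits a h D δ (proj₁ (orbit m)) (proj₂ (orbit m))) (*-congˡ (*-cong w≈ w≈)))
        where w≈ = *-congˡ (+-cong (sym (iterate-critical δ δ²≈Δ m)) (-‿cong (sym (iterate-critical (- δ) -δ²≈Δ m))))
      Q≈ : ∀ m → Q (orbit m) ≈ a * ((ι ℚ.½ * (X m + Y m) - h) * (ι ℚ.½ * (X m + Y m) - h))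
      Q≈ m = trans (Q-from-orbits a h D δ (proj₁ (orbit m)) (proj₂ (orbit m))) (*-congˡ (*-cong w≈ w≈))
        where w≈ = +-congʳ (*-congˡ (+-cong (sym (iterate-critical δ δ²≈Δ m)) (sym (iterate-critical (- δ) -δ²≈Δ m))))
      conclude : (∃[ i ] ∃[ k ] X (i ℕ.+ n) ≈ X (suc k ℕ.+ (i ℕ.+ n)) × Y (i ℕ.+ n) ≈ Y (suc k ℕ.+ (i ℕ.+ n))) →
        ∃[ i ] ∃[ k ] P (orbit (i ℕ.+ n)) ≈ P (orbit (suc k ℕ.+ (i ℕ.+ n))) × Q (orbit (i ℕ.+ n)) ≈ Q (orbit (suc k ℕ.+ (i ℕ.+ n)))
      conclude (i , k , X≈ , Y≈) = i , k ,
        trans (P≈ (i ℕ.+ n)) (trans (*-congˡ (*-cong w≈ w≈)) (sym (P≈ (suc k ℕ.+ (i ℕ.+ n))))) ,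
        trans (Q≈ (i ℕ.+ n)) (trans (*-congˡ (*-cong z≈ z≈)) (sym (Q≈ (suc k ℕ.+ (i ℕ.+ n)))))
        where
        w≈ = *-congˡ (+-cong X≈ (-‿cong Y≈))
        z≈ = +-congʳ (*-congˡ (+-cong X≈ Y≈))

    -- Every critical point is h + δ with δ² = Δ, so a repetition of the state orbit serves for all
    -- of them; a coordinate multiplied by 0 need not repeat.
    preperiodic⇒postcriticallyFinite : ∀ {i j} → i ℕ.< j → Δ ≈ 0# ⊎ proj₁ (orbit i) ≈ proj₁ (orbit j) →
      D ≈ 0# ⊎ proj₂ (orbit i) ≈ proj₂ (orbit j) → PostcriticallyFinite f
    preperiodic⇒postcriticallyFinite {i} {j} i<j u≈ v≈ α critical = preperiodic⇒finite f α i<j (begin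
      iterate (eval f) α i                                    ≈⟨ iterate-cong f i (complete-square h α) ⟩
      iterate (eval f) (h + δ) i                              ≈⟨ iterate-critical δ δ²≈Δ i ⟩
      h + (δ * proj₁ (orbit i) + D * proj₂ (orbit i))         ≈⟨ +-congˡ (+-cong ([ δ-irrelevant , *-congˡ ]′ u≈) ([ D-irrelevant , *-congˡ ]′ v≈)) ⟩
      h + (δ * proj₁ (orbit j) + D * proj₂ (orbit j))         ≈⟨ iterate-critical δ δ²≈Δ j ⟨
      iterate (eval f) (h + δ) j                              ≈⟨ iterate-cong f j (complete-square h α) ⟨
      iterate (eval f) α j                                    ∎)
      where
      δ = α - h
      δ²≈Δ = critical⇒ α critical
      irrelevant : ∀ {x y z} → x ≈ 0# → x * y ≈ x * z
      irrelevant x≈0 = trans (trans (*-congʳ x≈0) (zeroˡ _)) (sym (trans (*-congʳ x≈0) (zeroˡ _)))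
      δ-irrelevant : Δ ≈ 0# → δ * proj₁ (orbit i) ≈ δ * proj₁ (orbit j)
      δ-irrelevant Δ≈0 = irrelevant (square≈0 (trans δ²≈Δ Δ≈0))
      D-irrelevant : D ≈ 0# → D * proj₂ (orbit i) ≈ D * proj₂ (orbit j)
      D-irrelevant = irrelevant

  -- Descent to ℚ

  open Transfer ℚ.+-*-commutativeRing K id (Identity.isRingHomomorphism +-*-rawRing ≡.refl) ι ι-isHomomorphism ι-isHomomorphism

  ι≡ : ∀ {p q x} → p ≡ q → ι q ≈ x → ι p ≈ x
  ι≡ ≡.refl eq = eq

  module _ {f : ℚ[z].Poly} {nf : NormalForm} (F : f HasNormalFormℚ nf) where

    open NormalForm nf
    private
      module F = _HasNormalFormℚ_ F
      module O₁ = ℚ-Orbit A e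
      module O₂ = Orbit (ι a * ι Δ) (ι a * (ι D * ι D))

    embed-normalForm : HasNormalForm (embed f) (ι a) (ι h) (ι Δ) (ι D)
    embed-normalForm = record
      { a#0         = ι-#0 F.a≢0
      ; coeff₀      = trans (coeff-embed f 0) (ι≡ F.coeff₀ (φ-coefficient₀ a h Δ D))
      ; coeff₁      = trans (coeff-embed f 1) (ι≡ F.coeff₁ (φ-coefficient₁ a h Δ D))
      ; coeff₂      = trans (coeff-embed f 2) (ι≡ F.coeff₂ (φ-coefficient₂ a h Δ D))
      ; coeff₃      = trans (coeff-embed f 3) (ι≡ F.coeff₃ refl)
      ; coeff-above = λ n → trans (coeff-embed f (4 ℕ.+ n)) (ι≡ (F.coeff-above n) 0#-homo)
      }

    -- The critical orbits need not be rational, but `P` and `Q` are images of rational numbers and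
    -- `ι` is injective, so their coincidences hold already in ℚ.
    postcriticallyFinite⇒ℚ-recurrent : PostcriticallyFinite (embed f) → O₁.Recurrent
    postcriticallyFinite⇒ℚ-recurrent pcf n = descend (postcriticallyFinite⇒recurrent embed-normalForm pcf n)
      where
      descend : (∃[ i ] ∃[ k ] O₂.P (O₂.orbit (i ℕ.+ n)) ≈ O₂.P (O₂.orbit (suc k ℕ.+ (i ℕ.+ n))) × O₂.Q (O₂.orbit (i ℕ.+ n)) ≈ O₂.Q (O₂.orbit (suc k ℕ.+ (i ℕ.+ n)))) →
        ∃[ i ] ∃[ k ] O₁.P (O₁.orbit (i ℕ.+ n)) ≡ O₁.P (O₁.orbit (suc k ℕ.+ (i ℕ.+ n))) × O₁.Q (O₁.orbit (i ℕ.+ n)) ≡ O₁.Q (O₁.orbit (suc k ℕ.+ (i ℕ.+ n)))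
      descend (i , k , P≈ , Q≈) = i , k ,
        ι-injective (trans (φ-P a h Δ D (i ℕ.+ n)) (trans P≈ (sym (φ-P a h Δ D (suc k ℕ.+ (i ℕ.+ n)))))) ,
        ι-injective (trans (φ-Q a h Δ D (i ℕ.+ n)) (trans Q≈ (sym (φ-Q a h Δ D (suc k ℕ.+ (i ℕ.+ n))))))

    ℚ-preperiodic⇒postcriticallyFinite : ∀ {i j} → i ℕ.< j → Preperiodic nf i j → PostcriticallyFinite (embed f)
    ℚ-preperiodic⇒postcriticallyFinite {i} {j} i<j (u≡ , v≡) = preperiodic⇒postcriticallyFinite embed-normalForm i<j
      (descend (proj₁ (φ-orbit a h Δ D i)) (proj₁ (φ-orbit a h Δ D j)) u≡)
      (descend (proj₂ (φ-orbit a h Δ D i)) (proj₂ (φ-orbit a h Δ D j)) v≡)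
      where
      descend : ∀ {p q r x y} → ι p ≈ x → ι q ≈ y → r ≡ 0ℚ ⊎ p ≡ q → ι r ≈ 0# ⊎ x ≈ y
      descend p≈ q≈ (inj₁ r≡0) = inj₁ (ι≡ r≡0 0#-homo)
      descend p≈ q≈ (inj₂ p≡q) = inj₂ (trans (sym p≈) (ι≡ p≡q q≈))

  module _ {f g : ℚ[z].Poly} {nf nf′ : NormalForm} (F : f HasNormalFormℚ nf) (G : g HasNormalFormℚ nf′) where

    private
      module N = NormalForm nf
      module N′ = NormalForm nf′

    conjugate⇒ℚ-invariants : Conjugate (embed f) (embed g) → N.A ≡ N′.A × N.e ≡ N′.e
    conjugate⇒ℚ-invariants conj =
      ι-injective (trans (φ-A N.a N.h N.Δ N.D) (trans (proj₁ invariants) (sym (φ-A N′.a N′.h N′.Δ N′.D)))) ,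
      ι-injective (trans (φ-e N.a N.h N.Δ N.D) (trans (proj₂ invariants) (sym (φ-e N′.a N′.h N′.Δ N′.D))))
      where invariants = conjugate⇒invariants (embed-normalForm F) (embed-normalForm G) conj

    ℚ-invariants⇒conjugate : N.A ≡ N′.A → N.e ≡ N′.e → Conjugate (embed f) (embed g)
    ℚ-invariants⇒conjugate A≡ e≡ = invariants⇒conjugate (embed-normalForm F) (embed-normalForm G)
      (trans (sym (φ-A N.a N.h N.Δ N.D)) (ι≡ A≡ (φ-A N′.a N′.h N′.Δ N′.D)))
      (trans (sym (φ-e N.a N.h N.Δ N.D)) (ι≡ e≡ (φ-e N′.a N′.h N′.Δ N′.D)))

mainTheorem1 : ∀ {c ℓ₁ ℓ₂} (ℚ̄ : AlgebraicClosureOfℚ c ℓ₁ ℓ₂) →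
    let open AlgebraicClosureOfℚ ℚ̄
        rep : Fin 15 → Poly
        rep i = embed (lookup representatives i)
    in
      (∀ i → PostcriticallyFinite (rep i))
      × (∀ i j → i ≢ j → ¬ Conjugate (rep i) (rep j))
      × (∀ (f : ℚ[z].Poly) → ℚ[z].HasDegree f 3 → PostcriticallyFinite (embed f) →
           ∃[ i ] Conjugate (embed f) (rep i))
mainTheorem1 ℚ̄ =
  (λ i → ℚ-preperiodic⇒postcriticallyFinite (representative-normalForm i) 2<8 (preperiodic i)) ,
  (λ i j i≢j conj → i≢j (distinct i j conj)) ,
  λ f degree pcf → classify f (normalise f degree) pcf
  where
  open AlgebraicClosureOfℚ ℚ̄
  open OverClosure ℚ̄

  2<8 : 2 ℕ.< 8
  2<8 = toWitness {a? = 2 ℕ.<? 8} _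

  distinct : ∀ i j → Conjugate (embed (lookup representatives i)) (embed (lookup representatives j)) → i ≡ j
  distinct i j conj = invariants-distinct i j (proj₁ invariants) (proj₂ invariants)
    where invariants = conjugate⇒ℚ-invariants (representative-normalForm i) (representative-normalForm j) conj

  classify : ∀ f → ∃[ nf ] f HasNormalFormℚ nf → PostcriticallyFinite (embed f) →
    ∃[ i ] Conjugate (embed f) (embed (lookup representatives i))
  classify f (nf , F) pcf = fromListed (recurrent⇒listed (NormalForm.A nf) (NormalForm.e nf) (postcriticallyFinite⇒ℚ-recurrent F pcf))
    where
    fromListed : Listed (NormalForm.A nf) (NormalForm.e nf) → ∃[ i ] Conjugate (embed f) (embed (lookup representatives i))
    fromListed (i , A≡ , e≡) = i , ℚ-invariants⇒conjugate F (representative-normalForm i) (≡.sym A≡) (≡.sym e≡)
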